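{- Schrijver's $\vartheta'$-function is not, in general, an upper bound on the Shannon capacity of a graph. Explicitly, let $G$ be the graph on $32$ vertices with vertex set $V(G)=\{0,1\}^5$ in which two vertices $u,v$ are adjacent if and only if $1\le d_{\mathrm H}(u,v)\le 2$, where $d_{\mathrm H}$ denotes the Hamming distance. Then $$\Theta(G)\;\ge\;\sqrt{\alpha(G\boxtimes G)}\;\ge\;\sqrt{20}\;>\;4\;=\;\vartheta'(G).$$ In particular, the inequality $\Theta(G)\le \vartheta'(G)$ fails for this graph.
   Context: All graphs are simple, finite, and undirected. $\alpha(G)$ denotes the independence number of $G$ (the maximum size of a set of pairwise non-adjacent vertices). Strong product: for graphs $G$ and $H$, $G\boxtimes H$ is the graph with vertex set $V(G)\times V(H)$, where distinct vertices $(g,h)$ and $(g',h')$ are adjacent if and only if one of the following holds: (1) $g=g'$ and $\{h,h'\}\in E(H)$; (2) $\{g,g'\}\in E(G)$ and $h=h'$; (3) $\{g,g'\}\in E(G)$ and $\{h,h'\}\in E(H)$. For $k\in\mathbb{N}$ (positive integers), $G^{\boxtimes k}=G\boxtimes\cdots\boxtimes G$ is the strong product of $k$ copies of $G$. Shannon capacity: $\Theta(G)=\sup_{k\in\mathbb{N}}\sqrt[k]{\alpha(G^{\boxtimes k})}$. Schrijver's $\vartheta'$-function: for a graph $G$ on $n$ vertices with adjacency matrix $A=(A_{i,j})$, $\vartheta'(G)$ is the optimal value of the semidefinite program: minimize $\lambda_{\max}(X)$ over all real symmetric $n\times n$ matrices $X$ such that $X_{i,j}\ge 1$ for all $i,j\in\{1,\ldots,n\}$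 with $A_{i,j}=0$ (including the diagonal entries $i=j$). Here $\lambda_{\max}(X)$ is the largest eigenvalue of $X$. -}

module Defs where

open import Algebra.Bundles using (CommutativeRing; Semiring)
open import Algebra.Structures using (IsCommutativeRing)
import Algebra.Definitions.RawMonoid as RawMonoidOps
import Algebra.Definitions.RawSemiring as RawSemiringOps
open import Data.Bool.Base using (Bool; true; false; _xor_)
open import Data.Fin.Base using (Fin)
open import Data.Fin.Properties using (1↔⊤; 2↔Bool; *↔×; all?) renaming (_≟_ to _≟ᶠ_)
open import Data.Fin.Subset using (Subset; _∈_; ∣_∣; ⊥)
open import Data.Fin.Subset.Properties using (_∈?_; anySubset?; ∣p∣≤n; ∉⊥; ∣⊥∣≡0)
open import Data.Nat.Base as ℕ using (ℕ; zero; suc; NonZero)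
import Data.Nat.Properties as ℕ
open import Data.Product.Base using (Σ; ∃; ∃-syntax; _×_; _,_; proj₁)
open import Data.Product.Function.NonDependent.Propositional using (_×-↔_)
open import Data.Sum.Base using (_⊎_; inj₁; inj₂)
open import Data.Unit.Base using (tt)
open import Data.Vec.Base using (Vec; []; _∷_; zipWith; countᵇ)
open import Function.Base using (id; _∘_)
open import Function.Bundles using (_↔_; mk↔ₛ′; module Inverse)
open import Function.Construct.Composition using (_↔-∘_)
open import Level using (0ℓ)
open import Relation.Binary.Core using (Rel)
import Relation.Binary.Construct.NonStrictToStrict as NonStrictToStrict
open import Relation.Binary.Definitions using (Decidable; DecidableEquality; Symmetric; Irreflexive)
open import Relation.Binary.PropositionalEquality
  using (_≡_; refl; sym; trans; cong; subst)
open import Relation.Binary.Structures using (IsDecTotalOrder)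
open import Relation.Nullary.Decidable using (Dec; yes; no; ¬?; _×-dec_; _⊎-dec_; _→-dec_; map′)
open import Relation.Nullary.Negation using (¬_; contradiction)
open import Relation.Unary using (Pred)

module Bounds {A : Set} (_≤_ : Rel A 0ℓ) where

  IsUpperBound IsLowerBound : Pred A 0ℓ → Pred A 0ℓ
  IsUpperBound P b = ∀ x → P x → x ≤ b
  IsLowerBound P b = ∀ x → P x → b ≤ x

  IsSupremum IsInfimum : Pred A 0ℓ → Pred A 0ℓ
  IsSupremum P s = IsUpperBound P s × (∀ b → IsUpperBound P b → s ≤ b)
  IsInfimum  P s = IsLowerBound P s × (∀ b → IsLowerBound P b → b ≤ s)

-- ℝ is axiomatised rather than constructed: classically it is the only model
-- up to isomorphism.  The reals are the classical ones: decidability of the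
-- order together with suprema of arbitrary bounded inhabited predicates implies
-- excluded middle for Set, and conversely excluded middle gives a model.

record RealNumbers : Set₁ where
  infix  8 -_
  infixl 7 _*_
  infixl 6 _+_
  infix  4 _≈_ _≤_
  field
    Carrier           : Set
    _≈_ _≤_           : Rel Carrier 0ℓ
    _+_ _*_           : Carrier → Carrier → Carrier
    -_                : Carrier → Carrier
    0# 1#             : Carrier
    isCommutativeRing : IsCommutativeRing _≈_ _+_ _*_ -_ 0# 1#
    isDecTotalOrder   : IsDecTotalOrder _≈_ _≤_
    0≉1               : ¬ (0# ≈ 1#)
    inverse           : ∀ x → ¬ (x ≈ 0#) → ∃[ y ] (x * y ≈ 1#)
    +-monoˡ-≤         : ∀ z {x y} → x ≤ y → x + z ≤ y + z
    *-nonNeg          : ∀ {x y} → 0# ≤ x → 0# ≤ y → 0# ≤ x * y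

  open Bounds _≤_ public

  field
    complete : ∀ (P : Pred Carrier 0ℓ) → ∃ P → ∃ (IsUpperBound P) → ∃ (IsSupremum P)

  commutativeRing : CommutativeRing 0ℓ 0ℓ
  commutativeRing = record { isCommutativeRing = isCommutativeRing }

  open NonStrictToStrict _≈_ _≤_ public using (_<_)
  open RawMonoidOps (CommutativeRing.+-rawMonoid commutativeRing) public
    using (sum) renaming (_×_ to _·_)
  open RawSemiringOps (Semiring.rawSemiring (CommutativeRing.semiring commutativeRing)) public
    using (_^_)

  fromℕ : ℕ → Carrier
  fromℕ n = n · 1#

  IsRoot : ℕ → Carrier → Pred Carrier 0ℓ
  IsRoot k a r = 0# ≤ r × r ^ k ≈ a

record Graph : Set₁ where
  field
    V           : Set
    order       : ℕ
    enumeration : Fin order ↔ V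
    Adj         : Rel V 0ℓ
    adj?        : Decidable Adj
    adj-sym     : Symmetric Adj
    adj-irrefl  : Irreflexive _≡_ Adj

  vertex : Fin order → V
  vertex = Inverse.to enumeration

  index : V → Fin order
  index = Inverse.from enumeration

  _≟ⱽ_ : DecidableEquality V
  u ≟ⱽ v = map′
    (λ eq → trans (sym (Inverse.strictlyInverseˡ enumeration u))
              (trans (cong vertex eq) (Inverse.strictlyInverseˡ enumeration v)))
    (cong index)
    (index u ≟ᶠ index v)

open Graph

-- No condition u ≢ v is needed: adjacency is irreflexive.
IsIndependent : (G : Graph) → Pred (Subset (order G)) 0ℓ
IsIndependent G I = ∀ i j → i ∈ I → j ∈ I → ¬ Adj G (vertex G i) (vertex G j)

IsIndependenceNumber : Graph → Pred ℕ 0ℓ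
IsIndependenceNumber G a =
  (∃[ I ] (IsIndependent G I × ∣ I ∣ ≡ a)) × (∀ I → IsIndependent G I → ∣ I ∣ ℕ.≤ a)

independent? : (G : Graph) (I : Subset (order G)) → Dec (IsIndependent G I)
independent? G I = all? λ i → all? λ j →
  (i ∈? I) →-dec ((j ∈? I) →-dec ¬? (adj? G (vertex G i) (vertex G j)))

-- Abstract, so that the exhaustive search is never run during type checking.
abstract
  independenceNumber : (G : Graph) → ∃ (IsIndependenceNumber G)
  independenceNumber G = search (order G) (λ I _ → ∣p∣≤n I)
    where
    search : ∀ m → (∀ I → IsIndependent G I → ∣ I ∣ ℕ.≤ m) → ∃ (IsIndependenceNumber G)
    search m bound with anySubset? (λ I → independent? G I ×-dec (∣ I ∣ ℕ.≟ m))
    search m       bound | yes found = m , found , bound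
    search zero    bound | no none =
      contradiction (⊥ , (λ i j i∈⊥ → contradiction i∈⊥ ∉⊥) , ∣⊥∣≡0 (order G)) none
    search (suc m) bound | no none = search m λ I ind →
      ℕ.s≤s⁻¹ (ℕ.≤∧≢⇒< (bound I ind) (λ eq → none (I , ind , eq)))

α : Graph → ℕ
α G = proj₁ (independenceNumber G)

infixr 7 _⊠_
_⊠_ : Graph → Graph → Graph
G ⊠ H = record
  { V           = V G × V H
  ; order       = order G ℕ.* order H
  ; enumeration = (enumeration G ×-↔ enumeration H) ↔-∘ *↔× {order G} {order H}
  ; Adj         = λ where
      (g , h) (g′ , h′) →
        (g ≡ g′ × Adj H h h′) ⊎ (Adj G g g′ × h ≡ h′) ⊎ (Adj G g g′ × Adj H h h′)
  ; adj?        = λ where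
      (g , h) (g′ , h′) →
        (_≟ⱽ_ G g g′ ×-dec adj? H h h′)
          ⊎-dec ((adj? G g g′ ×-dec _≟ⱽ_ H h h′)
          ⊎-dec (adj? G g g′ ×-dec adj? H h h′))
  ; adj-sym     = λ where
      (inj₁ (p , e))        → inj₁ (sym p , adj-sym H e)
      (inj₂ (inj₁ (e , p))) → inj₂ (inj₁ (adj-sym G e , sym p))
      (inj₂ (inj₂ (e , f))) → inj₂ (inj₂ (adj-sym G e , adj-sym H f))
  ; adj-irrefl  = λ where
      refl (inj₁ (_ , e))        → adj-irrefl H refl e
      refl (inj₂ (inj₁ (e , _))) → adj-irrefl G refl e
      refl (inj₂ (inj₂ (e , _))) → adj-irrefl G refl e
  }

infixr 8 _^⊠_
_^⊠_ : Graph → (k : ℕ) → .{{NonZero k}} → Graph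
G ^⊠ suc zero    = G
G ^⊠ suc (suc k) = G ⊠ (G ^⊠ suc k)

module _ (ℝ : RealNumbers) where
  open RealNumbers ℝ

  IsShannonCapacity : Graph → Pred Carrier 0ℓ
  IsShannonCapacity G = IsSupremum λ r →
    Σ ℕ λ k → Σ (NonZero k) λ k≢0 → IsRoot k (fromℕ (α ((G ^⊠ k) {{k≢0}}))) r

  VertexVector VertexMatrix : Graph → Set
  VertexVector G = V G → Carrier
  VertexMatrix G = V G → V G → Carrier

  ∑ : (G : Graph) → VertexVector G → Carrier
  ∑ G f = sum (f ∘ vertex G)

  IsEigenvalue : (G : Graph) → VertexMatrix G → Pred Carrier 0ℓ
  IsEigenvalue G X μ = Σ (VertexVector G) λ v →
    ¬ (∀ i → v i ≈ 0#) × (∀ i → ∑ G (λ j → X i j * v j) ≈ μ * v i)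

  IsLargestEigenvalue : (G : Graph) → VertexMatrix G → Pred Carrier 0ℓ
  IsLargestEigenvalue G X μ = IsEigenvalue G X μ × IsUpperBound (IsEigenvalue G X) μ

  -- On the diagonal the second condition applies since adjacency is irreflexive.
  IsFeasible : (G : Graph) → Pred (VertexMatrix G) 0ℓ
  IsFeasible G X = (∀ i j → X i j ≈ X j i) × (∀ i j → ¬ Adj G i j → 1# ≤ X i j)

  IsSchrijverTheta : Graph → Pred Carrier 0ℓ
  IsSchrijverTheta G = IsInfimum λ μ →
    Σ (VertexMatrix G) λ X → IsFeasible G X × IsLargestEigenvalue G X μ

hammingDistance : ∀ {n} → Vec Bool n → Vec Bool n → ℕ
hammingDistance u v = countᵇ id (zipWith _xor_ u v)

hammingDistance-refl : ∀ {n} (u : Vec Bool n) → hammingDistance u u ≡ 0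
hammingDistance-refl []          = refl
hammingDistance-refl (true  ∷ u) = hammingDistance-refl u
hammingDistance-refl (false ∷ u) = hammingDistance-refl u

hammingDistance-sym : ∀ {n} (u v : Vec Bool n) → hammingDistance u v ≡ hammingDistance v u
hammingDistance-sym []          []          = refl
hammingDistance-sym (true  ∷ u) (true  ∷ v) = hammingDistance-sym u v
hammingDistance-sym (true  ∷ u) (false ∷ v) = cong suc (hammingDistance-sym u v)
hammingDistance-sym (false ∷ u) (true  ∷ v) = cong suc (hammingDistance-sym u v)
hammingDistance-sym (false ∷ u) (false ∷ v) = hammingDistance-sym u v

bitVectors : ∀ n → Fin (2 ℕ.^ n) ↔ Vec Bool n
bitVectors zero    = mk↔ₛ′ (λ _ → []) (λ _ → tt) (λ { [] → refl }) (λ _ → refl) ↔-∘ 1↔⊤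
bitVectors (suc n) = cons ↔-∘ ((2↔Bool ×-↔ bitVectors n) ↔-∘ *↔× {2} {2 ℕ.^ n})
  where
  cons : (Bool × Vec Bool n) ↔ Vec Bool (suc n)
  cons = mk↔ₛ′ (λ (b , u) → b ∷ u) (λ { (b ∷ u) → b , u })
               (λ { (b ∷ u) → refl }) (λ { (b , u) → refl })

hammingGraph : Graph
hammingGraph = record
  { V           = Vec Bool 5
  ; order       = 2 ℕ.^ 5
  ; enumeration = bitVectors 5
  ; Adj         = λ u v → 1 ℕ.≤ hammingDistance u v × hammingDistance u v ℕ.≤ 2
  ; adj?        = λ u v → (1 ℕ.≤? hammingDistance u v) ×-dec (hammingDistance u v ℕ.≤? 2)
  ; adj-sym     = λ {u} {v} → subst (λ d → 1 ℕ.≤ d × d ℕ.≤ 2) (hammingDistance-sym u v)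
  ; adj-irrefl  = λ { {u} refl (1≤d , _) →
                      contradiction (subst (1 ℕ.≤_) (hammingDistance-refl u) 1≤d) λ () }
  }

{-# OPTIONS --safe #-}

-- ϑ′ ≤ 4: with X(u,v) depending only on d(u,v), as 1, −1, −1, 1, 1, 3 for d = 0, …, 5,
-- the matrix 2(4I − X) is the Gram matrix of six characters of {0,1}⁵, and the
-- constant vector is an eigenvector of X for 4.  ϑ′ ≥ 4: for an independent set I of
-- size 4 and X feasible, 1_Iᵀ X 1_I ≥ |I|², so λ_max(X) ≥ |I| by the Rayleigh bound.
-- That bound is proved without the spectral theorem, from completeness and the
-- fact that a positive semidefinite matrix is singular or positive definite (by
-- induction on Schur complements).  Finally, twenty explicit pairs of words, found by
-- computer search, are independent in G ⊠ G.

module Submission where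

open import Defs
open import Algebra.Bundles using (CommutativeRing)
import Algebra.Definitions.RawMonoid as RawMonoidOps
import Algebra.Properties.AbelianGroup as AbelianGroupProperties
import Algebra.Properties.Monoid.Mult.TCOptimised as MultTCO
import Algebra.Properties.Ring as RingProperties
import Algebra.Properties.Semiring.Mult as SemiringMult
import Algebra.Properties.Semiring.Mult.TCOptimised as SemiringMultTCO
import Algebra.Properties.Semiring.Sum as SemiringSum
import Algebra.Solver.Ring as RingSolver
open import Algebra.Solver.Ring.AlmostCommutativeRing
  using (fromCommutativeRing; _-Raw-AlmostCommutative⟶_)
open import Data.Bool.Base using (Bool; true; false; if_then_else_)
open import Data.Fin.Base using (Fin; zero; suc)
open import Data.Fin.Properties using (all?; suc-injective) renaming (_≟_ to _≟ᶠ_)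
open import Data.Fin.Subset using (Subset; _∈_; ∣_∣; ⊥; ⁅_⁆; _∪_)
open import Data.Fin.Subset.Properties
  using (∉⊥; x∈⁅x⁆; x∈⁅y⁆⇒x≡y; x∈p∪q⁻; p⊆p∪q; q⊆p∪q; p⊂q⇒∣p∣<∣q∣; ∣p∣≤n)
open import Data.Integer.Base as ℤ using (ℤ; +_; -[1+_]; _⊖_)
import Data.Integer.Properties as ℤ
import Data.Maybe.Base as Maybe
open import Data.Nat.Base as ℕ using (ℕ; zero; suc; NonZero; z≤n; s≤s)
import Data.Nat.Properties as ℕ
open import Data.Product using (_×_; _,_; proj₁; proj₂; ∃-syntax)
open import Data.Sum using (_⊎_; inj₁; inj₂; [_,_]′)
open import Data.Unit.Base using (tt)
open import Data.Vec.Base using (Vec; []; _∷_; here; there; lookup; foldr′; map)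
open import Data.Vec.Functional using () renaming (_∷_ to _◂_)
open import Function.Base using (_∘_)
open import Function.Bundles using (module Inverse)
open import Function.Definitions using (Injective)
open import Relation.Binary.Bundles using (DecTotalOrder)
import Relation.Binary.Construct.NonStrictToStrict as NonStrictToStrict
import Relation.Binary.Properties.DecTotalOrder as DecTotalOrderProperties
import Relation.Binary.PropositionalEquality as ≡
open import Relation.Binary.PropositionalEquality using (_≡_)
import Relation.Binary.Reasoning.PartialOrder as PartialOrderReasoning
open import Relation.Binary.Structures using (IsDecTotalOrder)
open import Relation.Nullary using (¬_; yes; no; contradiction)
open import Relation.Nullary.Decidable
  using (dec⇒maybe; decidable-stable; toWitness; ¬?; _→-dec_)

-- The reals are an abstract record: nothing in them evaluates, and no eigenvalue is known to exist
-- in advance. Both facts shape the proof. Every finite check (the codes, the Gram identity, the row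
-- sums) is decided on words and integers, and the integer identities are carried to ℝ by the ring
-- homomorphism `fromℤ`; the weights 1/2 in the Gram decomposition are cleared by doubling. A
-- feasible X, on the other hand, is arbitrary and comes with a μ that bounds its eigenvalues, not
-- its quadratic form. Bounding the form by μ means manufacturing an eigenvalue from any violation,
-- and this is where completeness enters. The upper bound 4 is easier: it only tests eigenvectors of
-- one explicit matrix. Since `α` is opaque too, it is reached through exhibited independent sets
-- and through the trivial bound by the order.

image : ∀ {m n} → (Fin m → Fin n) → Subset n
image {zero}  f = ⊥
image {suc m} f = ⁅ f zero ⁆ ∪ image (f ∘ suc)

∈-image⁻ : ∀ {m n} (f : Fin m → Fin n) {x} → x ∈ image f → ∃[ i ] x ≡ f i
∈-image⁻ {zero}  f x∈ = contradiction x∈ ∉⊥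
∈-image⁻ {suc m} f x∈ with x∈p∪q⁻ ⁅ f zero ⁆ (image (f ∘ suc)) x∈
... | inj₁ x∈⁅f₀⁆ = zero , x∈⁅y⁆⇒x≡y _ x∈⁅f₀⁆
... | inj₂ x∈rest = let (i , x≡fi) = ∈-image⁻ (f ∘ suc) x∈rest in suc i , x≡fi

-- Injectivity keeps `f zero` out of the image of the later indices, so adjoining it is a strict
-- inclusion and the size grows without any count of a union.
∣image∣ : ∀ {m n} (f : Fin m → Fin n) → Injective _≡_ _≡_ f → m ℕ.≤ ∣ image f ∣
∣image∣ {zero}  f inj = ℕ.z≤n
∣image∣ {suc m} f inj = ℕ.≤-<-trans (∣image∣ (f ∘ suc) (suc-injective ∘ inj)) (p⊂q⇒∣p∣<∣q∣
  ( q⊆p∪q ⁅ f zero ⁆ rest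
  , f zero , p⊆p∪q rest (x∈⁅x⁆ (f zero))
  , λ f₀∈ → let (i , f₀≡fi) = ∈-image⁻ (f ∘ suc) f₀∈ in contradiction (inj f₀≡fi) λ ()))
  where rest = image (f ∘ suc)

-- Independent families and bounds on the independence number

module _ (G : Graph) where
  open Graph G

  -- Reduces independence of a subset of all vertex indices to a check on the m² pairs of a short
  -- list, which is small enough to be decided by evaluation.
  independentFamily : ∀ {m} (f : Fin m → V) → Injective _≡_ _≡_ f → (∀ i j → ¬ Adj (f i) (f j)) →
    ∃[ I ] (IsIndependent G I × m ℕ.≤ ∣ I ∣)
  independentFamily f f-inj f-ind =
      image (index ∘ f)
    , independent
    , ∣image∣ (index ∘ f) (f-inj ∘ index-injective)
    where
    index-injective : Injective _≡_ _≡_ index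
    index-injective {u} {v} eq = ≡.trans (≡.sym (Inverse.strictlyInverseˡ enumeration u))
      (≡.trans (≡.cong vertex eq) (Inverse.strictlyInverseˡ enumeration v))

    vertex-image : ∀ {a} → a ∈ image (index ∘ f) → ∃[ i ] vertex a ≡ f i
    vertex-image a∈ = let (i , a≡) = ∈-image⁻ (index ∘ f) a∈ in
      i , ≡.trans (≡.cong vertex a≡) (Inverse.strictlyInverseˡ enumeration (f i))

    independent : IsIndependent G (image (index ∘ f))
    independent a b a∈ b∈ adj =
      let (i , a≡fi) = vertex-image a∈
          (j , b≡fj) = vertex-image b∈
      in f-ind i j (≡.subst₂ Adj a≡fi b≡fj adj)

  independent⇒≤α : ∀ I → IsIndependent G I → ∣ I ∣ ℕ.≤ α G
  independent⇒≤α = proj₂ (proj₂ (independenceNumber G))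

  α≤order : α G ℕ.≤ order
  α≤order with independenceNumber G
  ... | _ , (I , _ , ≡.refl) , _ = ∣p∣≤n I

order-^⊠ : ∀ G k .{{_ : NonZero k}} → Graph.order (G ^⊠ k) ≡ Graph.order G ℕ.^ k
order-^⊠ G (suc zero)    = ≡.sym (ℕ.*-identityʳ (Graph.order G))
order-^⊠ G (suc (suc k)) = ≡.cong (Graph.order G ℕ.*_) (order-^⊠ G (suc k))

-- The codes and the integer certificate

bits : (a b c d e : ℕ) → Vec Bool 5
bits a b c d e = map (λ { zero → false ; (suc _) → true }) (a ∷ b ∷ c ∷ d ∷ e ∷ [])

-- The linear code spanned by 11100 and 00111; its nonzero words have weights 3, 3 and 4.
code₄ : Vec (Vec Bool 5) 4
code₄ = bits 0 0 0 0 0 ∷ bits 1 1 1 0 0 ∷ bits 0 0 1 1 1 ∷ bits 1 1 0 1 1 ∷ []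

-- Distinct pairs are non-adjacent exactly when one of the two coordinates has distance at least 3.
-- The product of `code₄` with itself would give only 16 pairs.
code₂₀ : Vec (Vec Bool 5 × Vec Bool 5) 20
code₂₀ =
  (bits 0 0 0 0 0 , bits 0 0 0 0 0) ∷
  (bits 0 0 0 1 0 , bits 1 1 1 1 0) ∷
  (bits 0 0 0 1 1 , bits 0 1 0 1 1) ∷
  (bits 0 0 1 0 0 , bits 0 1 1 0 1) ∷
  (bits 0 0 1 0 1 , bits 1 0 1 1 1) ∷
  (bits 0 0 1 1 1 , bits 1 0 0 0 0) ∷
  (bits 0 1 0 0 0 , bits 1 0 0 1 1) ∷
  (bits 0 1 0 0 1 , bits 1 1 1 0 0) ∷
  (bits 0 1 0 1 1 , bits 0 0 1 0 1) ∷
  (bits 0 1 1 0 1 , bits 0 1 0 1 0) ∷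
  (bits 1 0 0 1 0 , bits 1 0 1 0 1) ∷
  (bits 1 0 1 0 0 , bits 1 1 0 1 0) ∷
  (bits 1 0 1 1 0 , bits 0 0 0 1 1) ∷
  (bits 1 0 1 1 1 , bits 0 1 1 0 0) ∷
  (bits 1 1 0 0 0 , bits 0 1 1 1 1) ∷
  (bits 1 1 0 1 0 , bits 0 1 0 0 0) ∷
  (bits 1 1 0 1 1 , bits 1 0 0 1 0) ∷
  (bits 1 1 1 0 0 , bits 1 0 1 0 0) ∷
  (bits 1 1 1 0 1 , bits 0 0 0 0 1) ∷
  (bits 1 1 1 1 1 , bits 1 1 1 1 1) ∷ []

code₄-independent : ∃[ I ] (IsIndependent hammingGraph I × 4 ℕ.≤ ∣ I ∣)
code₄-independent = independentFamily hammingGraph f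
  (λ {i} {j} → toWitness {a? = all? λ i → all? λ j → (f i ≟ⱽ f j) →-dec (i ≟ᶠ j)} tt i j)
  (toWitness {a? = all? λ i → all? λ j → ¬? (adj? (f i) (f j))} tt)
  where
  open Graph hammingGraph
  f = lookup code₄

code₂₀-independent : ∃[ I ] (IsIndependent (hammingGraph ⊠ hammingGraph) I × 20 ℕ.≤ ∣ I ∣)
code₂₀-independent = independentFamily (hammingGraph ⊠ hammingGraph) f
  (λ {i} {j} → toWitness {a? = all? λ i → all? λ j → (f i ≟ⱽ f j) →-dec (i ≟ᶠ j)} tt i j)
  (toWitness {a? = all? λ i → all? λ j → ¬? (adj? (f i) (f j))} tt)
  where
  open Graph (hammingGraph ⊠ hammingGraph)
  f = lookup code₂₀

-- The entry of X at Hamming distance d (distances above 5 do not occur).  4I − X is half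
-- the Gram matrix of the characters u ↦ (−1)^⟨u,s⟩ with |s| ∈ {1, 5}; this choice of s and
-- of the weights solves Delsarte's linear program for binary codes of length 5 and distance 3.
entry : ℕ → ℤ
entry 0 = + 1
entry 1 = -[1+ 0 ]
entry 2 = -[1+ 0 ]
entry 3 = + 1
entry 4 = + 1
entry _ = + 3

-- The head is the character with s = 11111, the tail the five with |s| = 1. At distance d their
-- products sum to (-1)^d + 5 - 2d, that is 6, 2, 2, -2, -2, -6 for d = 0, ..., 5: twice the entries
-- of 4I - X.
characters : Vec Bool 5 → Vec ℤ 6
characters u = foldr′ ℤ._*_ (+ 1) signs ∷ signs
  where signs = map (λ b → if b then -[1+ 0 ] else + 1) u

-- Integer-valued, so that identities involving it can be decided, and recursive, so that sums
-- against it are handled by induction on the dimension.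
δ : ∀ {n} → Fin n → Fin n → ℤ
δ zero    zero    = + 1
δ zero    (suc j) = + 0
δ (suc i) zero    = + 0
δ (suc i) (suc j) = δ i j

δ-sym : ∀ {n} (i j : Fin n) → δ i j ≡ δ j i
δ-sym zero    zero    = ≡.refl
δ-sym zero    (suc j) = ≡.refl
δ-sym (suc i) zero    = ≡.refl
δ-sym (suc i) (suc j) = δ-sym i j

module Hamming where
  open Graph hammingGraph
  open RawMonoidOps ℤ.+-0-rawMonoid using (sum)

  entryAt : Fin order → Fin order → ℤ
  entryAt i j = entry (hammingDistance (vertex i) (vertex j))

  -- The entries of 4I - X, written as a sum with factor -1 so that `fromℤ` takes them summand by
  -- summand to `_·I-_`.
  gap : Fin order → Fin order → ℤ
  gap i j = + 4 ℤ.* δ i j ℤ.+ -[1+ 0 ] ℤ.* entryAt i j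

  character : Fin order → Fin 6 → ℤ
  character i = lookup (characters (vertex i))

  gram-characters : ∀ i j → sum (λ k → character i k ℤ.* character j k) ≡ gap i j ℤ.+ gap i j
  gram-characters = toWitness {a? = all? λ i → all? λ j →
    sum (λ k → character i k ℤ.* character j k) ℤ.≟ gap i j ℤ.+ gap i j} tt

  -- Grouped by distance, the row is 1 - 5 - 10 + 10 + 5 + 3. The factor `+ 1` makes the sum a
  -- product with the constant vector, as `fromℤ-∙` expects.
  rowSum : ∀ i → sum (λ j → entryAt i j ℤ.* + 1) ≡ + 4
  rowSum = toWitness {a? = all? λ i → sum (λ j → entryAt i j ℤ.* + 1) ℤ.≟ + 4} tt

module Real (ℝ : RealNumbers) where
  open RealNumbers ℝ
  open CommutativeRing commutativeRing
    using ( semiring; ring; +-monoid; +-abelianGroup; +-cong; +-congˡ; +-congʳ; *-cong; *-congˡ; *-congʳ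
          ; -‿cong; +-identityˡ; +-identityʳ; *-identityˡ; *-identityʳ; zeroˡ; zeroʳ
          ; +-comm; *-comm; -‿inverseʳ; refl; sym; trans; reflexive)
  open IsDecTotalOrder isDecTotalOrder
    using (_≟_; total; antisym; ≤-respˡ-≈; ≤-respʳ-≈)
    renaming (reflexive to ≤-reflexive; refl to ≤-refl; trans to ≤-trans)
  open SemiringMult semiring using (×1-homo-*)
  open SemiringSum semiring using () renaming (sum-cong-≋ to sum-cong)
  open RingProperties ring using (-‿distribˡ-*; -‿distribʳ-*; -0#≈0#; -1*x≈-x; -‿involutive)
  open AbelianGroupProperties +-abelianGroup using () renaming (⁻¹-∙-comm to -‿+-comm)
  open MultTCO +-monoid using (×ᵤ≈×)
    renaming (_×_ to _×ₜ_; ×-homo-+ to ×ₜ-homo-+)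
  open SemiringMultTCO semiring using () renaming (×1-homo-* to ×ₜ1-homo-*)

  decTotalOrder : DecTotalOrder _ _ _
  decTotalOrder = record { isDecTotalOrder = isDecTotalOrder }

  open DecTotalOrderProperties decTotalOrder using (<⇒≱; ≰⇒>; ≮⇒≥)
  open PartialOrderReasoning (DecTotalOrder.poset decTotalOrder) hiding (step-<)

  -- The embedding of the integers and the ring solver

  -- The type-checking-optimised multiple makes fromℤ (+ 1) definitionally 1#,
  -- so that con (+ 1) in solver terms denotes 1# itself.
  fromℤ : ℤ → Carrier
  fromℤ (+ n)      = n ×ₜ 1#
  fromℤ (-[1+ n ]) = - (suc n ×ₜ 1#)

  fromℤ-neg : ∀ z → fromℤ (ℤ.- z) ≈ - fromℤ z
  fromℤ-neg (+ zero)   = sym -0#≈0#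
  fromℤ-neg (+ suc n)  = refl
  fromℤ-neg (-[1+ n ]) = sym (-‿involutive _)

  -- The ring solver is built on `fromℤ`, so the homomorphism laws are proved by hand. Here 1 - 1 is
  -- inserted to undo the cancellation of the two successors.
  fromℤ-⊖ : ∀ m n → fromℤ (m ⊖ n) ≈ m ×ₜ 1# + - (n ×ₜ 1#)
  fromℤ-⊖ zero    zero    = sym (-‿inverseʳ _)
  fromℤ-⊖ zero    (suc n) = sym (+-identityˡ _)
  fromℤ-⊖ (suc m) zero    = sym (trans (+-congˡ -0#≈0#) (+-identityʳ _))
  fromℤ-⊖ (suc m) (suc n) = begin-equality
    fromℤ (suc m ⊖ suc n)                    ≡⟨ ≡.cong fromℤ (ℤ.[1+m]⊖[1+n]≡m⊖n m n) ⟩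
    fromℤ (m ⊖ n)                            ≈⟨ fromℤ-⊖ m n ⟩
    x + - y                                  ≈⟨ +-congʳ (+-identityˡ x) ⟨
    0# + x + - y                             ≈⟨ +-congʳ (+-congʳ (-‿inverseʳ 1#)) ⟨
    1# + - 1# + x + - y                      ≈⟨ shuffle ⟩
    (1# + x) + (- 1# + - y)                  ≈⟨ +-congˡ (-‿+-comm 1# y) ⟩
    (1# + x) + - (1# + y)                    ≈⟨ +-cong (×ₜ-homo-+ 1# 1 m) (-‿cong (×ₜ-homo-+ 1# 1 n)) ⟨
    suc m ×ₜ 1# + - (suc n ×ₜ 1#)            ∎
    where
    x = m ×ₜ 1#
    y = n ×ₜ 1#
    open CommutativeRing commutativeRing using (+-assoc)
    shuffle : 1# + - 1# + x + - y ≈ (1# + x) + (- 1# + - y)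
    shuffle = trans
      (+-congʳ (trans (+-assoc _ _ _) (trans (+-congˡ (+-comm _ _)) (sym (+-assoc _ _ _)))))
      (+-assoc _ _ _)

  fromℤ-+ : ∀ x y → fromℤ (x ℤ.+ y) ≈ fromℤ x + fromℤ y
  fromℤ-+ (+ m)      (+ n)      = ×ₜ-homo-+ 1# m n
  fromℤ-+ (+ m)      (-[1+ n ]) = fromℤ-⊖ m (suc n)
  fromℤ-+ (-[1+ m ]) (+ n)      = trans (fromℤ-⊖ n (suc m)) (+-comm _ _)
  fromℤ-+ (-[1+ m ]) (-[1+ n ]) = begin-equality
    - (suc (suc (m ℕ.+ n)) ×ₜ 1#)     ≡⟨ ≡.cong (λ k → - (suc k ×ₜ 1#)) (≡.sym (ℕ.+-suc m n)) ⟩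
    - ((suc m ℕ.+ suc n) ×ₜ 1#)       ≈⟨ -‿cong (×ₜ-homo-+ 1# (suc m) (suc n)) ⟩
    - (suc m ×ₜ 1# + suc n ×ₜ 1#)      ≈⟨ -‿+-comm _ _ ⟨
    - (suc m ×ₜ 1#) + - (suc n ×ₜ 1#)  ∎

  fromℤ-*-pos : ∀ m y → fromℤ (+ m ℤ.* y) ≈ fromℤ (+ m) * fromℤ y
  fromℤ-*-pos m (+ n) = trans (reflexive (≡.cong fromℤ (≡.sym (ℤ.pos-* m n)))) (×ₜ1-homo-* m n)
  fromℤ-*-pos m (-[1+ n ]) = begin-equality
    fromℤ (+ m ℤ.* -[1+ n ])             ≡⟨ ≡.cong fromℤ (ℤ.neg-distribʳ-* (+ m) (+ suc n)) ⟨
    fromℤ (ℤ.- (+ m ℤ.* + suc n))        ≈⟨ fromℤ-neg (+ m ℤ.* + suc n) ⟩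
    - fromℤ (+ m ℤ.* + suc n)            ≈⟨ -‿cong (fromℤ-*-pos m (+ suc n)) ⟩
    - (m ×ₜ 1# * (suc n ×ₜ 1#))            ≈⟨ -‿distribʳ-* _ _ ⟩
    m ×ₜ 1# * (- (suc n ×ₜ 1#))            ∎
  fromℤ-* : ∀ x y → fromℤ (x ℤ.* y) ≈ fromℤ x * fromℤ y
  fromℤ-* (+ m)      y = fromℤ-*-pos m y
  fromℤ-* (-[1+ m ]) y = begin-equality
    fromℤ (-[1+ m ] ℤ.* y)               ≡⟨ ≡.cong fromℤ (ℤ.neg-distribˡ-* (+ suc m) y) ⟨
    fromℤ (ℤ.- (+ suc m ℤ.* y))          ≈⟨ fromℤ-neg (+ suc m ℤ.* y) ⟩
    - fromℤ (+ suc m ℤ.* y)              ≈⟨ -‿cong (fromℤ-*-pos (suc m) y) ⟩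
    - (suc m ×ₜ 1# * fromℤ y)             ≈⟨ -‿distribˡ-* _ _ ⟩
    - (suc m ×ₜ 1#) * fromℤ y             ∎

  fromℤ-pos : ∀ n → fromℤ (+ n) ≈ fromℕ n
  fromℤ-pos n = sym (×ᵤ≈× n 1#)

  morphism : ℤ.+-*-rawRing -Raw-AlmostCommutative⟶ fromCommutativeRing commutativeRing
  morphism = record
    { ⟦_⟧    = fromℤ
    ; +-homo = fromℤ-+
    ; *-homo = fromℤ-*
    ; -‿homo = fromℤ-neg
    ; 0-homo = refl
    ; 1-homo = refl
    }

  open RingSolver ℤ.+-*-rawRing (fromCommutativeRing commutativeRing) morphism
    (λ x y → Maybe.map (λ p → reflexive (≡.cong fromℤ p)) (dec⇒maybe (x ℤ.≟ y)))
    using (solve; con; _:=_; _:+_; _:*_; :-_; _:-_)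

  -- Ordered fields

  ≤-by : ∀ {x y z} → 0# ≤ z → y ≈ x + z → x ≤ y
  ≤-by {x} {y} {z} 0≤z y≈x+z = begin
    x       ≈⟨ +-identityˡ x ⟨
    0# + x  ≤⟨ +-monoˡ-≤ x 0≤z ⟩
    z + x   ≈⟨ +-comm z x ⟩
    x + z   ≈⟨ y≈x+z ⟨
    y       ∎

  x≤y⇒0≤y-x : ∀ {x y} → x ≤ y → 0# ≤ y + - x
  x≤y⇒0≤y-x {x} {y} x≤y = begin
    0#       ≈⟨ -‿inverseʳ x ⟨
    x + - x  ≤⟨ +-monoˡ-≤ (- x) x≤y ⟩
    y + - x  ∎

  +-nonNeg : ∀ {x y} → 0# ≤ x → 0# ≤ y → 0# ≤ x + y
  +-nonNeg 0≤x 0≤y = ≤-trans 0≤x (≤-by 0≤y refl)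

  +-mono-≤ : ∀ {x y u v} → x ≤ y → u ≤ v → x + u ≤ y + v
  +-mono-≤ {x} {y} {u} {v} x≤y u≤v = ≤-by (+-nonNeg (x≤y⇒0≤y-x x≤y) (x≤y⇒0≤y-x u≤v))
    (solve 4 (λ x y u v → y :+ v := (x :+ u) :+ ((y :- x) :+ (v :- u))) refl x y u v)

  *-monoˡ-≤ : ∀ {c x y} → 0# ≤ c → x ≤ y → c * x ≤ c * y
  *-monoˡ-≤ {c} {x} {y} 0≤c x≤y = ≤-by (*-nonNeg 0≤c (x≤y⇒0≤y-x x≤y))
    (solve 3 (λ c x y → c :* y := c :* x :+ c :* (y :- x)) refl c x y)

  square-nonNeg : ∀ x → 0# ≤ x * x
  square-nonNeg x with total 0# x
  ... | inj₁ 0≤x = *-nonNeg 0≤x 0≤x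
  ... | inj₂ x≤0 = ≤-trans (*-nonNeg 0≤-x 0≤-x)
    (≤-reflexive (solve 1 (λ x → (con (+ 0) :- x) :* (con (+ 0) :- x) := x :* x) refl x))
    where 0≤-x = x≤y⇒0≤y-x x≤0

  0≤1 : 0# ≤ 1#
  0≤1 = ≤-trans (square-nonNeg 1#) (≤-reflexive (*-identityˡ 1#))

  0<1 : 0# < 1#
  0<1 = 0≤1 , 0≉1

  <-≤-trans : ∀ {x y z} → x < y → y ≤ z → x < z
  <-≤-trans = NonStrictToStrict.<-≤-trans _≈_ _≤_ sym ≤-trans antisym ≤-respʳ-≈

  ≤-<-trans : ∀ {x y z} → x ≤ y → y < z → x < z
  ≤-<-trans = NonStrictToStrict.≤-<-trans _≈_ _≤_ ≤-trans antisym ≤-respˡ-≈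

  x<y⇒0<y-x : ∀ {x y} → x < y → 0# < y + - x
  x<y⇒0<y-x {x} {y} (x≤y , x≉y) = x≤y⇒0≤y-x x≤y , λ 0≈y-x → x≉y (begin-equality
    x              ≈⟨ +-identityʳ x ⟨
    x + 0#         ≈⟨ +-congˡ 0≈y-x ⟩
    x + (y + - x)  ≈⟨ solve 2 (λ x y → x :+ (y :- x) := y) refl x y ⟩
    y              ∎)

  <-by : ∀ {x y z} → 0# < z → y ≈ x + z → x < y
  <-by {x} {y} {z} 0<z y≈x+z = ≰⇒> λ y≤x → <⇒≱ 0<z (begin
    z              ≈⟨ solve 2 (λ x z → z := x :+ z :- x) refl x z ⟩
    x + z + - x    ≈⟨ +-congʳ y≈x+z ⟨
    y + - x        ≤⟨ +-monoˡ-≤ (- x) y≤x ⟩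
    x + - x        ≈⟨ -‿inverseʳ x ⟩
    0#             ∎)

  +-pos-nonNeg : ∀ {x y} → 0# < x → 0# ≤ y → 0# < x + y
  +-pos-nonNeg 0<x 0≤y = <-≤-trans 0<x (≤-by 0≤y refl)

  recip : ∀ {x} → 0# < x → ∃[ y ] (0# < y × x * y ≈ 1#)
  recip {x} 0<x@(0≤x , 0≉x) with inverse x (λ x≈0 → 0≉x (sym x≈0))
  ... | y , xy≈1 = y , ≰⇒> y≰0 , xy≈1
    where
    y≰0 : ¬ (y ≤ 0#)
    y≰0 y≤0 = <⇒≱ 0<1 (≤-by (*-nonNeg 0≤x (x≤y⇒0≤y-x y≤0)) (begin-equality
      0#                          ≈⟨ solve 2 (λ x y → con (+ 0) := x :* y :+ x :* (con (+ 0) :- y)) refl x y ⟩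
      x * y + x * (0# + - y)      ≈⟨ +-congʳ xy≈1 ⟩
      1# + x * (0# + - y)         ∎))

  *-cancelˡ-≤ : ∀ {c x y} → 0# < c → c * x ≤ c * y → x ≤ y
  *-cancelˡ-≤ {c} {x} {y} 0<c cx≤cy with recip 0<c
  ... | d , (0≤d , _) , cd≈1 = begin
    x            ≈⟨ unit x ⟨
    d * (c * x)  ≤⟨ *-monoˡ-≤ 0≤d cx≤cy ⟩
    d * (c * y)  ≈⟨ unit y ⟩
    y            ∎
    where
    unit : ∀ z → d * (c * z) ≈ z
    unit z = begin-equality
      d * (c * z)  ≈⟨ solve 3 (λ c d z → d :* (c :* z) := c :* d :* z) refl c d z ⟩
      c * d * z    ≈⟨ *-congʳ cd≈1 ⟩
      1# * z       ≈⟨ *-identityˡ z ⟩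
      z            ∎

  *-pos : ∀ {x y} → 0# < x → 0# < y → 0# < x * y
  *-pos {x} {y} 0<x 0<y = ≰⇒> λ xy≤0 →
    <⇒≱ 0<y (*-cancelˡ-≤ 0<x (≤-trans xy≤0 (≤-reflexive (sym (zeroʳ x)))))

  quotient : ∀ {x y} → 0# < x → 0# < y → ∃[ q ] (0# < q × q * y ≈ x)
  quotient {x} {y} 0<x 0<y with recip 0<y
  ... | z , 0<z , yz≈1 = x * z , *-pos 0<x 0<z , (begin-equality
    x * z * y    ≈⟨ solve 3 (λ x y z → x :* z :* y := y :* z :* x) refl x y z ⟩
    y * z * x    ≈⟨ *-congʳ yz≈1 ⟩
    1# * x       ≈⟨ *-identityˡ x ⟩
    x            ∎)

  -- Natural numbers and roots

  fromℕ-nonNeg : ∀ n → 0# ≤ fromℕ n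
  fromℕ-nonNeg zero    = ≤-refl
  fromℕ-nonNeg (suc n) = +-nonNeg 0≤1 (fromℕ-nonNeg n)

  fromℕ-pos : ∀ n .{{_ : NonZero n}} → 0# < fromℕ n
  fromℕ-pos (suc n) = +-pos-nonNeg 0<1 (fromℕ-nonNeg n)

  fromℕ-mono-≤ : ∀ {m n} → m ℕ.≤ n → fromℕ m ≤ fromℕ n
  fromℕ-mono-≤ {n = n} ℕ.z≤n = fromℕ-nonNeg n
  fromℕ-mono-≤ (ℕ.s≤s m≤n)   = +-mono-≤ ≤-refl (fromℕ-mono-≤ m≤n)

  fromℕ-mono-< : ∀ {m n} → m ℕ.< n → fromℕ m < fromℕ n
  fromℕ-mono-< {m} m<n = <-≤-trans m<1+m (fromℕ-mono-≤ m<n)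
    where
    m<1+m : fromℕ m < fromℕ (suc m)
    m<1+m = ≰⇒> λ 1+m≤m → <⇒≱ 0<1 (begin
      1#                           ≈⟨ solve 1 (λ m → con (+ 1) := con (+ 1) :+ m :- m) refl (fromℕ m) ⟩
      fromℕ (suc m) + - fromℕ m    ≤⟨ +-monoˡ-≤ _ 1+m≤m ⟩
      fromℕ m + - fromℕ m          ≈⟨ -‿inverseʳ _ ⟩
      0#                           ∎)

  fromℕ-^ : ∀ m k → fromℕ (m ℕ.^ k) ≈ fromℕ m ^ k
  fromℕ-^ m zero    = +-identityʳ 1#
  fromℕ-^ m (suc k) = trans (×1-homo-* m (m ℕ.^ k)) (*-congˡ (fromℕ-^ m k))

  ^-nonNeg : ∀ {x} k → 0# ≤ x → 0# ≤ x ^ k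
  ^-nonNeg zero    0≤x = 0≤1
  ^-nonNeg (suc k) 0≤x = *-nonNeg 0≤x (^-nonNeg k 0≤x)

  ^-pos : ∀ {x} k → 0# < x → 0# < x ^ k
  ^-pos zero    0<x = 0<1
  ^-pos (suc k) 0<x = *-pos 0<x (^-pos k 0<x)

  ^-mono-≤ : ∀ {x y} k → 0# ≤ x → x ≤ y → x ^ k ≤ y ^ k
  ^-mono-≤ zero    0≤x x≤y = ≤-refl
  ^-mono-≤ {x} {y} (suc k) 0≤x x≤y = begin
    x * x ^ k  ≤⟨ *-monoˡ-≤ 0≤x (^-mono-≤ k 0≤x x≤y) ⟩
    x * y ^ k  ≈⟨ *-comm _ _ ⟩
    y ^ k * x  ≤⟨ *-monoˡ-≤ (^-nonNeg k (≤-trans 0≤x x≤y)) x≤y ⟩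
    y ^ k * y  ≈⟨ *-comm _ _ ⟩
    y * y ^ k  ∎

  -- For exponent k + 1: were y < x, then (x - y)xᵏ would be positive, although it is at most y(yᵏ -
  -- xᵏ) ≤ 0.
  ^-cancel-≤ : ∀ {x y} k .{{_ : NonZero k}} → 0# ≤ y → x ^ k ≤ y ^ k → x ≤ y
  ^-cancel-≤ {x} {y} (suc k) 0≤y xᵏ≤yᵏ = ≮⇒≥ λ y<x →
    <⇒≱ (*-pos (x<y⇒0<y-x y<x) (^-pos k (≤-<-trans 0≤y y<x))) (begin
      (x + - y) * x ^ k            ≈⟨ solve 3 (λ x y p → (x :- y) :* p := x :* p :- y :* p) refl x y (x ^ k) ⟩
      x * x ^ k + - (y * x ^ k)    ≤⟨ +-monoˡ-≤ _ xᵏ≤yᵏ ⟩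
      y * y ^ k + - (y * x ^ k)    ≤⟨ +-monoˡ-≤ _ (*-monoˡ-≤ 0≤y (^-mono-≤ k 0≤y (proj₁ y<x))) ⟩
      y * x ^ k + - (y * x ^ k)    ≈⟨ -‿inverseʳ _ ⟩
      0#                           ∎)

  root-mono-≤ : ∀ {a b r s} k .{{_ : NonZero k}} → IsRoot k a r → IsRoot k b s → a ≤ b → r ≤ s
  root-mono-≤ {a} {b} {r} {s} k (_ , rᵏ≈a) (0≤s , sᵏ≈b) a≤b = ^-cancel-≤ k 0≤s (begin
    r ^ k  ≈⟨ rᵏ≈a ⟩
    a      ≤⟨ a≤b ⟩
    b      ≈⟨ sᵏ≈b ⟨
    s ^ k  ∎)

  square-cancel-≤ : ∀ {x y} → 0# ≤ y → x * x ≤ y * y → x ≤ y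
  square-cancel-≤ {x} {y} 0≤y x²≤y² = ^-cancel-≤ 2 0≤y (begin
    x * (x * 1#)  ≈⟨ *-congˡ (*-identityʳ x) ⟩
    x * x         ≤⟨ x²≤y² ⟩
    y * y         ≈⟨ *-congˡ (*-identityʳ y) ⟨
    y * (y * 1#)  ∎)

  squareRoot : ∀ {a} → 0# ≤ a → ∃[ r ] IsRoot 2 a r
  squareRoot {a} 0≤a = s , 0≤s , trans (*-congˡ (*-identityʳ s)) (antisym s²≤a a≤s²)
    where
    P : Carrier → Set
    P x = x * x ≤ a

    0∈P : P 0#
    0∈P = ≤-trans (≤-reflexive (zeroˡ 0#)) 0≤a

    -- Since a ≤ (1 + a)², this bound avoids a case distinction on a ≤ 1.
    bound : IsUpperBound P (1# + a)
    bound x x²≤a = square-cancel-≤ (+-nonNeg 0≤1 0≤a) (≤-trans x²≤a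
      (≤-by (+-nonNeg (+-nonNeg 0≤1 0≤a) (square-nonNeg a))
        (solve 1 (λ a → (con (+ 1) :+ a) :* (con (+ 1) :+ a)
                     := a :+ (con (+ 1) :+ a :+ a :* a)) refl a)))

    supremum = complete P (0# , 0∈P) (1# + a , bound)
    s = proj₁ supremum
    s-upper = proj₁ (proj₂ supremum)
    s-least = proj₂ (proj₂ supremum)

    0≤s : 0# ≤ s
    0≤s = s-upper 0# 0∈P

    -- If s² < a, then s + δ still lies in P for δ = e / (2s + 1 + e), e = a − s².
    a≤s² : a ≤ s * s
    a≤s² = ≮⇒≥ λ s²<a →
      let e   = a + - (s * s)
          0<e = x<y⇒0<y-x s²<a
          D   = e + (s + s + 1#)
          0≤2s+1 = +-nonNeg (+-nonNeg 0≤s 0≤s) 0≤1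
          0<D = +-pos-nonNeg 0<e 0≤2s+1
          (δ , 0<δ , δD≈e) = quotient 0<e 0<D
          -- The summand e in D forces δ ≤ 1, hence δ² ≤ δ and 2sδ + δ² ≤ δ(2s + 1) ≤ e.
          δ≤1 : δ ≤ 1#
          δ≤1 = *-cancelˡ-≤ 0<D (begin
            D * δ   ≈⟨ *-comm D δ ⟩
            δ * D   ≈⟨ δD≈e ⟩
            e       ≤⟨ ≤-by 0≤2s+1 refl ⟩
            D       ≈⟨ *-identityʳ D ⟨
            D * 1#  ∎)
          s+δ∈P : P (s + δ)
          s+δ∈P = ≤-by (+-nonNeg (*-nonNeg (proj₁ 0<δ) (x≤y⇒0≤y-x δ≤1)) (*-nonNeg (proj₁ 0<δ) (proj₁ 0<e)))
            (begin-equality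
              a
                ≈⟨ solve 2 (λ a s → a := s :* s :+ (a :- s :* s)) refl a s ⟩
              s * s + e
                ≈⟨ +-congˡ δD≈e ⟨
              s * s + δ * (e + (s + s + 1#))
                ≈⟨ solve 3 (λ s δ e → s :* s :+ δ :* (e :+ (s :+ s :+ con (+ 1)))
                     := (s :+ δ) :* (s :+ δ) :+ (δ :* (con (+ 1) :- δ) :+ δ :* e)) refl s δ e ⟩
              (s + δ) * (s + δ) + (δ * (1# + - δ) + δ * e)
                ∎)
      in <⇒≱ 0<δ (begin
        δ              ≈⟨ solve 2 (λ s δ → δ := (s :+ δ) :- s) refl s δ ⟩
        s + δ + - s    ≤⟨ +-monoˡ-≤ (- s) (s-upper (s + δ) s+δ∈P) ⟩
        s + - s        ≈⟨ -‿inverseʳ s ⟩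
        0#             ∎)

    -- If a < s², then the Newton iterate s − δ, δ = (s² − a) / 2s, bounds P as well.
    s²≤a : s * s ≤ a
    s²≤a = ≮⇒≥ λ a<s² →
      let e   = s * s + - a
          0<e = x<y⇒0<y-x a<s²
          0<s : 0# < s
          0<s = ≰⇒> λ s≤0 → <⇒≱ a<s² (begin
            s * s   ≤⟨ *-monoˡ-≤ 0≤s s≤0 ⟩
            s * 0#  ≈⟨ zeroʳ s ⟩
            0#      ≤⟨ 0≤a ⟩
            a       ∎)
          0<2s = +-pos-nonNeg 0<s 0≤s
          (δ , 0<δ , δ2s≈e) = quotient 0<e 0<2s
          0≤s-δ : 0# ≤ s + - δ
          0≤s-δ = *-cancelˡ-≤ 0<2s (≤-by (+-nonNeg (square-nonNeg s) 0≤a) (begin-equality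
            (s + s) * (s + - δ)
              ≈⟨ solve 2 (λ s δ → (s :+ s) :* (s :- δ) := s :* s :+ s :* s :- δ :* (s :+ s)) refl s δ ⟩
            s * s + s * s + - (δ * (s + s))
              ≈⟨ +-congˡ (-‿cong δ2s≈e) ⟩
            s * s + s * s + - (s * s + - a)
              ≈⟨ solve 2 (λ a s → s :* s :+ s :* s :- (s :* s :- a)
                   := (s :+ s) :* con (+ 0) :+ (s :* s :+ a)) refl a s ⟩
            (s + s) * 0# + (s * s + a)
              ∎))
          a≤[s-δ]² : a ≤ (s + - δ) * (s + - δ)
          a≤[s-δ]² = ≤-by (square-nonNeg δ) (begin-equality
            (s + - δ) * (s + - δ)
              ≈⟨ solve 2 (λ s δ → (s :- δ) :* (s :- δ) := s :* s :- δ :* (s :+ s) :+ δ :* δ) refl s δ ⟩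
            s * s + - (δ * (s + s)) + δ * δ
              ≈⟨ +-congʳ (+-congˡ (-‿cong δ2s≈e)) ⟩
            s * s + - (s * s + - a) + δ * δ
              ≈⟨ +-congʳ (solve 2 (λ a s → s :* s :- (s :* s :- a) := a) refl a s) ⟩
            a + δ * δ
              ∎)
      in <⇒≱ 0<δ (begin
        δ                ≈⟨ solve 2 (λ s δ → δ := s :- (s :- δ)) refl s δ ⟩
        s + - (s + - δ)  ≤⟨ +-monoˡ-≤ _ (s-least (s + - δ) λ x x²≤a →
                              square-cancel-≤ 0≤s-δ (≤-trans x²≤a a≤[s-δ]²)) ⟩
        s + - δ + - (s + - δ)  ≈⟨ -‿inverseʳ _ ⟩
        0#               ∎)

  -- Quadratic forms

  Vector : ℕ → Set
  Vector n = Fin n → Carrier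

  Matrix : ℕ → Set
  Matrix n = Fin n → Fin n → Carrier

  -- Binds tighter than `_*_`: `K * v ∙ v` is K|v|², and `u ∙ v * u ∙ v` is a square.
  infix 8 _∙_
  _∙_ : ∀ {n} → Vector n → Vector n → Carrier
  u ∙ v = sum λ i → u i * v i

  form : ∀ {n} → Matrix n → Vector n → Carrier
  form M v = v ∙ λ i → M i ∙ v

  ∙-cong : ∀ {n} {u u′ v v′ : Vector n} → (∀ i → u i ≈ u′ i) → (∀ i → v i ≈ v′ i) → u ∙ v ≈ u′ ∙ v′
  ∙-cong {zero}  u≈u′ v≈v′ = refl
  ∙-cong {suc n} u≈u′ v≈v′ =
    +-cong (*-cong (u≈u′ zero) (v≈v′ zero)) (∙-cong (u≈u′ ∘ suc) (v≈v′ ∘ suc))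

  ∙-comm : ∀ {n} (u v : Vector n) → u ∙ v ≈ v ∙ u
  ∙-comm {zero}  u v = refl
  ∙-comm {suc n} u v = +-cong (*-comm _ _) (∙-comm (u ∘ suc) (v ∘ suc))

  ∙-linearʳ : ∀ {n} a b (u v w : Vector n) → u ∙ (λ i → a * v i + b * w i) ≈ a * (u ∙ v) + b * (u ∙ w)
  ∙-linearʳ {zero}  a b u v w = solve 2 (λ a b → con (+ 0) := a :* con (+ 0) :+ b :* con (+ 0)) refl a b
  ∙-linearʳ {suc n} a b u v w = trans (+-congˡ (∙-linearʳ a b (u ∘ suc) (v ∘ suc) (w ∘ suc)))
    (solve 7 (λ a b u v w p q → u :* (a :* v :+ b :* w) :+ (a :* p :+ b :* q)
                 := a :* (u :* v :+ p) :+ b :* (u :* w :+ q))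
      refl a b (u zero) (v zero) (w zero) (u ∘ suc ∙ v ∘ suc) (u ∘ suc ∙ w ∘ suc))

  ∙-linearˡ : ∀ {n} a b (u v w : Vector n) → (λ i → a * v i + b * w i) ∙ u ≈ a * (v ∙ u) + b * (w ∙ u)
  ∙-linearˡ a b u v w = begin-equality
    (λ i → a * v i + b * w i) ∙ u  ≈⟨ ∙-comm _ u ⟩
    u ∙ (λ i → a * v i + b * w i)  ≈⟨ ∙-linearʳ a b u v w ⟩
    a * (u ∙ v) + b * (u ∙ w)      ≈⟨ +-cong (*-congˡ (∙-comm u v)) (*-congˡ (∙-comm u w)) ⟩
    a * (v ∙ u) + b * (w ∙ u)      ∎

  ∙-homoʳ : ∀ {n} a (u v : Vector n) → u ∙ (λ i → a * v i) ≈ a * (u ∙ v)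
  ∙-homoʳ {zero}  a u v = sym (zeroʳ a)
  ∙-homoʳ {suc n} a u v = trans (+-congˡ (∙-homoʳ a (u ∘ suc) (v ∘ suc)))
    (solve 4 (λ a u v p → u :* (a :* v) :+ a :* p := a :* (u :* v :+ p))
      refl a (u zero) (v zero) (u ∘ suc ∙ v ∘ suc))

  ∙-homoˡ : ∀ {n} a (u v : Vector n) → (λ i → a * v i) ∙ u ≈ a * (v ∙ u)
  ∙-homoˡ a u v = trans (∙-comm _ u) (trans (∙-homoʳ a u v) (*-congˡ (∙-comm u v)))

  ∙-zeroˡ : ∀ {n} (v : Vector n) → (λ _ → 0#) ∙ v ≈ 0#
  ∙-zeroˡ {zero}  v = refl
  ∙-zeroˡ {suc n} v = trans (+-cong (zeroˡ _) (∙-zeroˡ (v ∘ suc))) (+-identityˡ 0#)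

  ∙-zeroʳ : ∀ {n} (v : Vector n) → v ∙ (λ _ → 0#) ≈ 0#
  ∙-zeroʳ v = trans (∙-comm v _) (∙-zeroˡ v)

  ∙-nonNeg : ∀ {n} (v : Vector n) → 0# ≤ v ∙ v
  ∙-nonNeg {zero}  v = ≤-refl
  ∙-nonNeg {suc n} v = +-nonNeg (square-nonNeg _) (∙-nonNeg (v ∘ suc))

  ∙-definite : ∀ {n} (v : Vector n) → v ∙ v ≈ 0# → ∀ i → v i ≈ 0#
  ∙-definite {suc n} v v∙v≈0 = λ where
      zero    → decidable-stable (v zero ≟ 0#) λ v₀≉0 → <⇒≱ (square-pos (v zero) v₀≉0) v₀²≤0
      (suc i) → ∙-definite (v ∘ suc) (antisym t∙t≤0 (∙-nonNeg (v ∘ suc))) i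
    where
    square-pos : ∀ x → ¬ (x ≈ 0#) → 0# < x * x
    square-pos x x≉0 = square-nonNeg x , λ 0≈x² → let (y , xy≈1) = inverse x x≉0 in 0≉1 (begin-equality
      0#                 ≈⟨ zeroˡ (y * y) ⟨
      0# * (y * y)       ≈⟨ *-congʳ 0≈x² ⟩
      x * x * (y * y)    ≈⟨ solve 2 (λ x y → x :* x :* (y :* y) := x :* y :* (x :* y)) refl x y ⟩
      x * y * (x * y)    ≈⟨ *-cong xy≈1 xy≈1 ⟩
      1# * 1#            ≈⟨ *-identityˡ 1# ⟩
      1#                 ∎)
    v₀²≤0 : v zero * v zero ≤ 0#
    v₀²≤0 = ≤-trans (≤-by (∙-nonNeg (v ∘ suc)) refl) (≤-reflexive v∙v≈0)
    t∙t≤0 : (v ∘ suc) ∙ (v ∘ suc) ≤ 0#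
    t∙t≤0 = ≤-trans (≤-by (square-nonNeg (v zero)) (+-comm _ _)) (≤-reflexive v∙v≈0)

  ∙-pos : ∀ {n} (v : Vector n) → ¬ (∀ i → v i ≈ 0#) → 0# < v ∙ v
  ∙-pos v v≉0 = ∙-nonNeg v , λ 0≈v∙v → v≉0 (∙-definite v (sym 0≈v∙v))

  -- Cauchy–Schwarz without the sharp constant.
  ∙-bounded : ∀ {n} (u : Vector n) → ∃[ K ] (0# ≤ K × ∀ v → u ∙ v * u ∙ v ≤ K * v ∙ v)
  ∙-bounded {zero}  u = 0# , ≤-refl , λ v → ≤-refl
  ∙-bounded {suc n} u with ∙-bounded (u ∘ suc)
  -- From (p + r)² ≤ 2p² + 2r² with p = u₀v₀ and r² ≤ Kw; the cross terms 2u₀²w and 2Kv₀² are slack.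
  ... | K , 0≤K , bound = u₀² + u₀² + (K + K) , +-nonNeg (+-nonNeg 0≤u₀² 0≤u₀²) (+-nonNeg 0≤K 0≤K) , λ v →
    let v₀ = v zero
        r  = u ∘ suc ∙ v ∘ suc
        w  = v ∘ suc ∙ v ∘ suc
        0≤w  = ∙-nonNeg (v ∘ suc)
        0≤Kw-r² = x≤y⇒0≤y-x (bound (v ∘ suc))
    in ≤-by (+-nonNeg (+-nonNeg (+-nonNeg (square-nonNeg (u₀ * v₀ + - r)) (+-nonNeg 0≤Kw-r² 0≤Kw-r²))
               (+-nonNeg (*-nonNeg 0≤u₀² 0≤w) (*-nonNeg 0≤u₀² 0≤w)))
               (+-nonNeg (*-nonNeg 0≤K (square-nonNeg v₀)) (*-nonNeg 0≤K (square-nonNeg v₀))))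
         (solve 5 (λ u v r w K →
             (u :* u :+ u :* u :+ (K :+ K)) :* (v :* v :+ w)
               := (u :* v :+ r) :* (u :* v :+ r)
                  :+ ((u :* v :- r) :* (u :* v :- r)
                      :+ ((K :* w :- r :* r) :+ (K :* w :- r :* r))
                      :+ (u :* u :* w :+ u :* u :* w)
                      :+ (K :* (v :* v) :+ K :* (v :* v))))
           refl u₀ v₀ r w K)
    where
    u₀ = u zero
    u₀² = u₀ * u₀
    0≤u₀² = square-nonNeg u₀

  form-linear : ∀ {n} a b (M N : Matrix n) v →
    form (λ i j → a * M i j + b * N i j) v ≈ a * form M v + b * form N v
  form-linear a b M N v = trans
    (∙-cong (λ _ → refl) (λ i → ∙-linearˡ a b v (M i) (N i)))
    (∙-linearʳ a b v (λ i → M i ∙ v) (λ i → N i ∙ v))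

  form-cong : ∀ {n} {M N : Matrix n} v → (∀ i j → M i j ≈ N i j) → form M v ≈ form N v
  form-cong v M≈N = ∙-cong (λ _ → refl) λ i → ∙-cong (M≈N i) λ _ → refl

  form-rankOne : ∀ {n} (c v : Vector n) → form (λ i j → c i * c j) v ≈ c ∙ v * c ∙ v
  form-rankOne c v = begin-equality
    v ∙ (λ i → (λ j → c i * c j) ∙ v)  ≈⟨ ∙-cong (λ _ → refl) (λ i → trans (∙-homoˡ (c i) v c) (*-comm _ _)) ⟩
    v ∙ (λ i → c ∙ v * c i)            ≈⟨ ∙-homoʳ (c ∙ v) v c ⟩
    c ∙ v * v ∙ c                      ≈⟨ *-congˡ (∙-comm v c) ⟩
    c ∙ v * c ∙ v                      ∎

  form-+ : ∀ {n} (M N : Matrix n) v → form (λ i j → M i j + N i j) v ≈ form M v + form N v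
  form-+ M N v = begin-equality
    form (λ i j → M i j + N i j) v
      ≈⟨ form-cong v (λ i j → +-cong (*-identityˡ _) (*-identityˡ _)) ⟨
    form (λ i j → 1# * M i j + 1# * N i j) v
      ≈⟨ form-linear 1# 1# M N v ⟩
    1# * form M v + 1# * form N v
      ≈⟨ +-cong (*-identityˡ _) (*-identityˡ _) ⟩
    form M v + form N v
      ∎

  -- A Gram matrix is a sum of rank-one matrices c cᵀ, one for each coordinate of the vectors; the
  -- induction splits off the first coordinate.
  gram-nonNeg : ∀ {n m} (C : Fin n → Vector m) v → 0# ≤ form (λ i j → C i ∙ C j) v
  gram-nonNeg {m = zero} C v = ≤-reflexive (sym (trans
    (∙-cong {u = v} (λ _ → refl) (λ _ → ∙-zeroˡ v)) (∙-zeroʳ v)))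
  gram-nonNeg {m = suc m} C v = begin
    0#
      ≤⟨ +-nonNeg (square-nonNeg (c ∙ v)) (gram-nonNeg (λ i → C i ∘ suc) v) ⟩
    c ∙ v * c ∙ v + form T v
      ≈⟨ +-congʳ (form-rankOne c v) ⟨
    form (λ i j → c i * c j) v + form T v
      ≈⟨ form-+ (λ i j → c i * c j) T v ⟨
    form (λ i j → C i ∙ C j) v
      ∎
    where
    c = λ i → C i zero
    T = λ i j → (C i ∘ suc) ∙ (C j ∘ suc)

  δ-∙ : ∀ {n} (v : Vector n) i → (fromℤ ∘ δ i) ∙ v ≈ v i
  δ-∙ v zero    = trans (+-cong (*-identityˡ _) (∙-zeroˡ (v ∘ suc))) (+-identityʳ _)
  δ-∙ v (suc i) = trans (+-cong (zeroˡ _) (δ-∙ (v ∘ suc) i)) (+-identityˡ _)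

  form-δ : ∀ {n} (v : Vector n) → form (λ i j → fromℤ (δ i j)) v ≈ v ∙ v
  form-δ v = ∙-cong (λ _ → refl) (δ-∙ v)

  -- Supplies the upper bound under which `rayleigh` takes its supremum. It follows from v·Mv ≤ |v|²
  -- + |Mv|², with |Mv|² bounded row by row.
  form-bounded : ∀ {n} (M : Matrix n) → ∃[ K ] ∀ v → form M v ≤ K * v ∙ v
  form-bounded M = 1# + total-K , λ v → ≤-trans (AMGM v (λ i → M i ∙ v)) (≤-trans
      (+-mono-≤ ≤-refl (rows M v))
      (≤-reflexive (solve 2 (λ K w → w :+ K :* w := (con (+ 1) :+ K) :* w) refl total-K (v ∙ v))))
    where
    rowK : ∀ {m n} → (Fin m → Vector n) → Vector m
    rowK N i = proj₁ (∙-bounded (N i))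
    total-K = sum (rowK M)
    AMGM : ∀ {n} (u w : Vector n) → u ∙ w ≤ u ∙ u + w ∙ w
    AMGM {zero}  u w = ≤-reflexive (sym (+-identityˡ 0#))
    AMGM {suc n} u w = ≤-trans (+-mono-≤ (xy≤x²+y² (u zero) (w zero)) (AMGM (u ∘ suc) (w ∘ suc)))
      (≤-reflexive (solve 4 (λ a b p q → (a :+ b) :+ (p :+ q) := a :+ p :+ (b :+ q)) refl
        (u zero * u zero) (w zero * w zero) (u ∘ suc ∙ u ∘ suc) (w ∘ suc ∙ w ∘ suc)))
      where
      xy≤x²+y² : ∀ x y → x * y ≤ x * x + y * y
      xy≤x²+y² x y with total 0# (x * y)
      ... | inj₁ 0≤xy = ≤-by (+-nonNeg (square-nonNeg (x + - y)) 0≤xy)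
        (solve 2 (λ x y → x :* x :+ y :* y := x :* y :+ ((x :- y) :* (x :- y) :+ x :* y)) refl x y)
      ... | inj₂ xy≤0 = ≤-trans xy≤0 (+-nonNeg (square-nonNeg x) (square-nonNeg y))
    rows : ∀ {m n} (N : Fin m → Vector n) v →
           (λ i → N i ∙ v) ∙ (λ i → N i ∙ v) ≤ sum (rowK N) * v ∙ v
    rows {zero}  N v = ≤-reflexive (sym (zeroˡ _))
    rows {suc m} N v = ≤-trans
      (+-mono-≤ (proj₂ (proj₂ (∙-bounded (N zero))) v) (rows (N ∘ suc) v))
      (≤-reflexive (solve 3 (λ k K w → k :* w :+ K :* w := (k :+ K) :* w) refl
        (rowK N zero) (sum (rowK (N ∘ suc))) (v ∙ v)))

  -- Positive semidefinite matrices

  -- Definiteness carries a uniform ε. Deriving it from pointwise positivity would take compactness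
  -- of the sphere; the Schur induction builds it directly, and it is the amount by which a supremum
  -- can be lowered.
  IsSymmetric PositiveSemidefinite PositiveDefinite Singular : ∀ {n} → Matrix n → Set
  IsSymmetric M          = ∀ i j → M i j ≈ M j i
  PositiveSemidefinite M = ∀ v → 0# ≤ form M v
  PositiveDefinite M     = ∃[ ε ] (0# < ε × ∀ v → ε * v ∙ v ≤ form M v)
  Singular M             = ∃[ v ] (¬ (∀ i → v i ≈ 0#) × ∀ i → M i ∙ v ≈ 0#)

  module Block {n} (M : Matrix (suc n)) (M-sym : IsSymmetric M) where

    a = M zero zero
    b = M zero ∘ suc
    C = λ i j → M (suc i) (suc j)

    form-block : ∀ y w → form M (y ◂ w) ≈ a * (y * y) + (y * b ∙ w + y * b ∙ w) + form C w
    form-block y w = begin-equality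
      y * (a * y + b ∙ w) + w ∙ (λ i → M (suc i) zero * y + C i ∙ w)
        ≈⟨ +-congˡ (∙-cong {u = w} (λ _ → refl) λ i → +-cong
             (trans (*-congʳ (M-sym (suc i) zero)) (*-comm _ _)) (sym (*-identityˡ _))) ⟩
      y * (a * y + b ∙ w) + w ∙ (λ i → y * b i + 1# * C i ∙ w)
        ≈⟨ +-congˡ (∙-linearʳ y 1# w b (λ i → C i ∙ w)) ⟩
      y * (a * y + b ∙ w) + (y * w ∙ b + 1# * form C w)
        ≈⟨ +-congˡ (+-congʳ (*-congˡ (∙-comm w b))) ⟩
      y * (a * y + b ∙ w) + (y * b ∙ w + 1# * form C w)
        ≈⟨ solve 4 (λ a y β F → y :* (a :* y :+ β) :+ (y :* β :+ con (+ 1) :* F)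
             := a :* (y :* y) :+ (y :* β :+ y :* β) :+ F) refl a y (b ∙ w) (form C w) ⟩
      a * (y * y) + (y * b ∙ w + y * b ∙ w) + form C w
        ∎

    cornerNonNeg : PositiveSemidefinite M → 0# ≤ a
    cornerNonNeg psd = ≤-trans (psd (1# ◂ λ _ → 0#)) (≤-reflexive (begin-equality
      form M (1# ◂ λ _ → 0#)
        ≈⟨ form-block 1# (λ _ → 0#) ⟩
      a * (1# * 1#) + (1# * b ∙ (λ _ → 0#) + 1# * b ∙ (λ _ → 0#)) + form C (λ _ → 0#)
        ≈⟨ +-cong (+-congˡ (+-cong (*-congˡ (∙-zeroʳ b)) (*-congˡ (∙-zeroʳ b)))) (∙-zeroˡ (λ i → C i ∙ λ _ → 0#)) ⟩
      a * (1# * 1#) + (1# * 0# + 1# * 0#) + 0#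
        ≈⟨ solve 1 (λ a → a :* (con (+ 1) :* con (+ 1))
             :+ (con (+ 1) :* con (+ 0) :+ con (+ 1) :* con (+ 0)) :+ con (+ 0) := a) refl a ⟩
      a
        ∎))

    -- A positive semidefinite matrix with a zero in the corner has a zero first
    -- row: along (y, b) the form is affine in y with slope 2 |b|².
    zeroCorner : PositiveSemidefinite M → a ≈ 0# → ∀ i → b i ≈ 0#
    zeroCorner psd a≈0 = ∙-definite b (decidable-stable (b ∙ b ≟ 0#) λ b∙b≉0 →
      let 0<b∙b          = ∙-nonNeg b , λ 0≈b∙b → b∙b≉0 (sym 0≈b∙b)
          (z , _ , bbz≈1) = recip (+-pos-nonNeg 0<b∙b (∙-nonNeg b))
          F              = form C b
          -- As the corner vanishes, the form at (y, b) is 2y|b|² + F; this y makes it -1.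
          y              = - ((F + 1#) * z)
      in <⇒≱ 0<1 (≤-by (psd (y ◂ b)) (begin-equality
        0#
          ≈⟨ solve 1 (λ F → con (+ 0) := con (+ 1) :+ (con (+ 0) :+ :- ((F :+ con (+ 1)) :* con (+ 1)) :+ F)) refl F ⟩
        1# + (0# + - ((F + 1#) * 1#) + F)
          ≈⟨ +-congˡ (+-congʳ (+-congˡ (-‿cong (*-congˡ (sym bbz≈1))))) ⟩
        1# + (0# + - ((F + 1#) * ((b ∙ b + b ∙ b) * z)) + F)
          ≈⟨ solve 3 (λ F β z → con (+ 1) :+ (con (+ 0) :+ :- ((F :+ con (+ 1)) :* ((β :+ β) :* z)) :+ F)
               := con (+ 1) :+ (con (+ 0) :* (:- ((F :+ con (+ 1)) :* z) :* :- ((F :+ con (+ 1)) :* z))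
                                :+ (:- ((F :+ con (+ 1)) :* z) :* β :+ :- ((F :+ con (+ 1)) :* z) :* β) :+ F))
               refl F (b ∙ b) z ⟩
        1# + (0# * (y * y) + (y * b ∙ b + y * b ∙ b) + F)
          ≈⟨ +-congˡ (+-congʳ (+-congʳ (*-congʳ a≈0))) ⟨
        1# + (a * (y * y) + (y * b ∙ b + y * b ∙ b) + F)
          ≈⟨ +-congˡ (form-block y b) ⟨
        1# + form M (y ◂ b)
          ∎)))

    module Schur (0<a : 0# < a) where

      c = proj₁ (recip 0<a)

      ac≈1 : a * c ≈ 1#
      ac≈1 = proj₂ (proj₂ (recip 0<a))

      -- The Schur complement C - bbᵀ/a, in the shape expected by `form-linear` and `∙-linearˡ`.
      S : Matrix n
      S i j = 1# * C i j + - c * (b i * b j)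

      S-sym : IsSymmetric S
      S-sym i j = +-cong (*-congˡ (M-sym (suc i) (suc j))) (*-congˡ (*-comm _ _))

      form-S : ∀ w → form S w ≈ form C w + - (c * (b ∙ w * b ∙ w))
      form-S w = begin-equality
        form S w
          ≈⟨ form-linear 1# (- c) C (λ i j → b i * b j) w ⟩
        1# * form C w + - c * form (λ i j → b i * b j) w
          ≈⟨ +-congˡ (*-congˡ (form-rankOne b w)) ⟩
        1# * form C w + - c * (b ∙ w * b ∙ w)
          ≈⟨ solve 3 (λ F c β → con (+ 1) :* F :+ :- c :* (β :* β) := F :- c :* (β :* β))
               refl (form C w) c (b ∙ w) ⟩
        form C w + - (c * (b ∙ w * b ∙ w))
          ∎

      completeSquare : ∀ y w → form M (y ◂ w) ≈ a * ((y + c * b ∙ w) * (y + c * b ∙ w)) + form S w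
      completeSquare y w = begin-equality
        form M (y ◂ w)
          ≈⟨ form-block y w ⟩
        a * (y * y) + (y * β + y * β) + F
          -- The term cβ² is added to the square and removed from F; the factor 1 marks the place
          -- where ac is substituted.
          ≈⟨ solve 5 (λ a y β F c → a :* (y :* y) :+ (y :* β :+ y :* β) :+ F
               := a :* (y :* y) :+ con (+ 1) :* (y :* β :+ y :* β :+ c :* (β :* β)) :+ (F :- c :* (β :* β)))
               refl a y β F c ⟩
        a * (y * y) + 1# * (y * β + y * β + c * (β * β)) + (F + - (c * (β * β)))
          ≈⟨ +-cong (+-congˡ (*-congʳ ac≈1)) (form-S w) ⟨
        a * (y * y) + a * c * (y * β + y * β + c * (β * β)) + form S w
          ≈⟨ solve 5 (λ a y β F c → a :* (y :* y) :+ a :* c :* (y :* β :+ y :* β :+ c :* (β :* β)) :+ F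
               := a :* ((y :+ c :* β) :* (y :+ c :* β)) :+ F)
               refl a y β (form S w) c ⟩
        a * ((y + c * β) * (y + c * β)) + form S w
          ∎
        where
        β = b ∙ w
        F = form C w

      -- At (-c(b·w), w) the completed square vanishes and only the form of S remains.
      S-psd : PositiveSemidefinite M → PositiveSemidefinite S
      S-psd psd w = ≤-trans (psd (- (c * b ∙ w) ◂ w)) (≤-reflexive (trans
        (completeSquare _ w)
        (solve 3 (λ a β F → a :* ((:- β :+ β) :* (:- β :+ β)) :+ F := F) refl a (c * b ∙ w) (form S w))))

      -- The new entry y = -cβ solves the first row ay + β = 0; substituting it turns the other rows
      -- into those of Sw.
      S-singular : Singular S → Singular M
      S-singular (w , w≉0 , Sw≈0) = v , (λ v≈0 → w≉0 (v≈0 ∘ suc)) , λ where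
          zero    → begin-equality
            a * - (c * β) + β
              ≈⟨ solve 3 (λ a c β → a :* :- (c :* β) :+ β := β :- a :* c :* β) refl a c β ⟩
            β + - (a * c * β)
              ≈⟨ +-congˡ (-‿cong (*-congʳ ac≈1)) ⟩
            β + - (1# * β)
              ≈⟨ solve 1 (λ β → β :- con (+ 1) :* β := con (+ 0)) refl β ⟩
            0#
              ∎
          (suc i) → begin-equality
            M (suc i) zero * - (c * β) + C i ∙ w
              ≈⟨ +-congʳ (*-congʳ (M-sym (suc i) zero)) ⟩
            b i * - (c * β) + C i ∙ w
              ≈⟨ solve 4 (λ b c β r → b :* :- (c :* β) :+ r := con (+ 1) :* r :+ :- c :* (b :* β))
                   refl (b i) c β (C i ∙ w) ⟩
            1# * C i ∙ w + - c * (b i * β)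
              ≈⟨ +-congˡ (*-congˡ (∙-homoˡ (b i) w b)) ⟨
            1# * C i ∙ w + - c * (λ j → b i * b j) ∙ w
              ≈⟨ ∙-linearˡ 1# (- c) w (C i) (λ j → b i * b j) ⟨
            S i ∙ w
              ≈⟨ Sw≈0 i ⟩
            0#
              ∎
        where
        β = b ∙ w
        v = - (c * β) ◂ w

      -- With β = c(b·w) and p = y + β, the form is at least ap² + ε|w|², while y² ≤ 2p² + 2β² ≤ 2p²
      -- + 2K|w|². So η has to satisfy 2η ≤ a and ηK′ ≤ ε; the choice η = aε/(2ε + K′a) meets both
      -- without taking a minimum.
      S-definite : PositiveDefinite S → PositiveDefinite M
      S-definite (ε , 0<ε , ε-bound) = η , 0<η , λ v →
        bound (v zero) (v ∘ suc)
        where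
        K        = proj₁ (∙-bounded (λ i → c * b i))
        0≤K      = proj₁ (proj₂ (∙-bounded (λ i → c * b i)))
        K′       = K + K + 1#
        0≤K′     = +-nonNeg (+-nonNeg 0≤K 0≤K) 0≤1
        D        = ε + ε + K′ * a
        0<D      = +-pos-nonNeg (+-pos-nonNeg 0<ε (proj₁ 0<ε)) (*-nonNeg 0≤K′ (proj₁ 0<a))
        quot     = quotient (*-pos 0<a 0<ε) 0<D
        η        = proj₁ quot
        0<η      = proj₁ (proj₂ quot)
        ηD≈aε    = proj₂ (proj₂ quot)

        bound : ∀ y w → η * (y * y + w ∙ w) ≤ form M (y ◂ w)
        bound y w = *-cancelˡ-≤ 0<D (begin
          D * (η * (y * y + W))
            ≈⟨ solve 3 (λ D η N → D :* (η :* N) := η :* D :* N) refl D η (y * y + W) ⟩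
          η * D * (y * y + W)
            ≈⟨ *-congʳ ηD≈aε ⟩
          a * ε * (y * y + W)
            ≤⟨ *-monoˡ-≤ (*-nonNeg (proj₁ 0<a) (proj₁ 0<ε)) N≤R ⟩
          a * ε * (p² + p² + K′ * W)
            ≤⟨ ≤-by (+-nonNeg (*-nonNeg 0≤K′ (*-nonNeg (square-nonNeg a) (square-nonNeg (y + β))))
                              (*-nonNeg (+-nonNeg (square-nonNeg ε) (square-nonNeg ε)) (∙-nonNeg w)))
                 (solve 5 (λ a ε k p w → (ε :+ ε :+ k :* a) :* (a :* p :+ ε :* w)
                    := a :* ε :* (p :+ p :+ k :* w) :+ (k :* (a :* a :* p) :+ (ε :* ε :+ ε :* ε) :* w))
                    refl a ε K′ p² W) ⟩
          D * (a * p² + ε * W)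
            ≤⟨ *-monoˡ-≤ (proj₁ 0<D) (+-mono-≤ ≤-refl (ε-bound w)) ⟩
          D * (a * p² + form S w)
            ≈⟨ *-congˡ (completeSquare y w) ⟨
          D * form M (y ◂ w)
            ∎)
          where
          W  = w ∙ w
          β  = c * b ∙ w
          p² = (y + β) * (y + β)

          β²≤KW : β * β ≤ K * W
          β²≤KW = ≤-trans (≤-reflexive (sym (*-cong (∙-homoˡ c w b) (∙-homoˡ c w b))))
                          (proj₂ (proj₂ (∙-bounded (λ i → c * b i))) w)

          0≤KW-β² = x≤y⇒0≤y-x β²≤KW

          N≤R : y * y + W ≤ p² + p² + K′ * W
          N≤R = ≤-by (+-nonNeg (square-nonNeg (y + β + β)) (+-nonNeg 0≤KW-β² 0≤KW-β²))
            (solve 4 (λ y β K W →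
                (y :+ β) :* (y :+ β) :+ (y :+ β) :* (y :+ β) :+ (K :+ K :+ con (+ 1)) :* W
                  := y :* y :+ W :+ ((y :+ β :+ β) :* (y :+ β :+ β)
                                     :+ ((K :* W :- β :* β) :+ (K :* W :- β :* β))))
              refl y β K W)

  -- A zero corner has a zero row and column, so the first basis vector lies in the kernel; a
  -- positive corner lets either alternative for the Schur complement lift to M.
  psd⇒singularOrDefinite : ∀ {n} (M : Matrix n) → IsSymmetric M → PositiveSemidefinite M →
    Singular M ⊎ PositiveDefinite M
  psd⇒singularOrDefinite {zero}  M M-sym psd = inj₂ (1# , 0<1 , λ v → ≤-reflexive (zeroʳ 1#))
  psd⇒singularOrDefinite {suc n} M M-sym psd with M zero zero ≟ 0#
  ... | yes a≈0 = inj₁ (1# ◂ (λ _ → 0#) , (λ e≈0 → 0≉1 (sym (e≈0 zero))) , λ where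
          zero    → column zero a≈0
          (suc i) → column (suc i) (trans (M-sym (suc i) zero) (zeroCorner psd a≈0 i)))
    where
    open Block M M-sym
    column : ∀ i → M i zero ≈ 0# → M i ∙ (1# ◂ λ _ → 0#) ≈ 0#
    column i Mi0≈0 = trans (+-cong (trans (*-identityʳ _) Mi0≈0) (∙-zeroʳ (M i ∘ suc))) (+-identityˡ 0#)
  ... | no  a≉0 = [ inj₁ ∘ S-singular , inj₂ ∘ S-definite ]′ (psd⇒singularOrDefinite S S-sym (S-psd psd))
    where
    open Block M M-sym
    open Schur (cornerNonNeg psd , λ 0≈a → a≉0 (sym 0≈a))

  -- The Rayleigh bound

  Eigenvalue : ∀ {n} → Matrix n → Carrier → Set
  Eigenvalue M t = ∃[ v ] (¬ (∀ i → v i ≈ 0#) × ∀ i → M i ∙ v ≈ t * v i)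

  _·I-_ : ∀ {n} → Carrier → Matrix n → Matrix n
  (t ·I- M) i j = t * fromℤ (δ i j) + - 1# * M i j

  form-·I- : ∀ {n} t (M : Matrix n) v → form (t ·I- M) v ≈ t * v ∙ v + - form M v
  form-·I- t M v = begin-equality
    form (t ·I- M) v
      ≈⟨ form-linear t (- 1#) (λ i j → fromℤ (δ i j)) M v ⟩
    t * form (λ i j → fromℤ (δ i j)) v + - 1# * form M v
      ≈⟨ +-cong (*-congˡ (form-δ v)) (-1*x≈-x _) ⟩
    t * v ∙ v + - form M v
      ∎

  singular⇒eigenvalue : ∀ {n} t (M : Matrix n) → Singular (t ·I- M) → Eigenvalue M t
  singular⇒eigenvalue t M (v , v≉0 , Nv≈0) = v , v≉0 , λ i → begin-equality
    M i ∙ v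
      ≈⟨ +-identityˡ _ ⟨
    0# + M i ∙ v
      ≈⟨ +-congʳ (Nv≈0 i) ⟨
    (t ·I- M) i ∙ v + M i ∙ v
      ≈⟨ +-congʳ (∙-linearˡ t (- 1#) v (λ j → fromℤ (δ i j)) (M i)) ⟩
    t * (fromℤ ∘ δ i) ∙ v + - 1# * M i ∙ v + M i ∙ v
      ≈⟨ +-congʳ (+-congʳ (*-congˡ (δ-∙ v i))) ⟩
    t * v i + - 1# * M i ∙ v + M i ∙ v
      ≈⟨ solve 2 (λ x y → x :+ :- con (+ 1) :* y :+ y := x) refl (t * v i) (M i ∙ v) ⟩
    t * v i
      ∎

  -- Were the form to exceed μ |v|² somewhere, the supremum s of the t for which
  -- t I − M is not positive semidefinite would be an eigenvalue: s I − M is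
  -- positive semidefinite by the choice of s, and not definite, since then s
  -- could be lowered.
  rayleigh : ∀ {n} (M : Matrix n) → IsSymmetric M → ∀ μ → IsUpperBound (Eigenvalue M) μ →
    ∀ v → form M v ≤ μ * v ∙ v
  rayleigh {n} M M-sym μ μ-upper v₀ = ≮⇒≥ λ μ∈P → exceeds (v₀ , μ∈P)
    where
    P : Carrier → Set
    P t = ∃[ v ] (t * v ∙ v < form M v)

    scale-≤ : ∀ {t u} (v : Vector n) → t ≤ u → t * v ∙ v ≤ u * v ∙ v
    scale-≤ v t≤u = ≤-trans (≤-reflexive (*-comm _ _))
      (≤-trans (*-monoˡ-≤ (∙-nonNeg v) t≤u) (≤-reflexive (*-comm _ _)))

    bounds : ∀ u → (∀ v → form M v ≤ u * v ∙ v) → IsUpperBound P u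
    bounds u form≤ t (v , t<) = ≮⇒≥ λ (u≤t , _) → <⇒≱ t< (≤-trans (form≤ v) (scale-≤ v u≤t))

    exceeds : ¬ P μ
    exceeds μ∈P@(vμ , μ<) =
        -- In the singular case s is an eigenvalue, so s ≤ μ and the form at `vμ` is at most μ|vμ|²,
        -- against the choice of `vμ`.
        [ (λ singular → <⇒≱ μ< (≤-trans (s-form vμ) (scale-≤ vμ (μ-upper s (singular⇒eigenvalue s M singular)))))
        , (λ (ε , 0<ε , ε-bound) → <⇒≱ 0<ε (begin
            ε                ≈⟨ solve 2 (λ s ε → ε := s :- (s :- ε)) refl s ε ⟩
            s + - (s + - ε)  ≤⟨ +-monoˡ-≤ _ (s-least (s + - ε) (bounds _ (lower ε ε-bound))) ⟩
            s + - ε + - (s + - ε)  ≈⟨ -‿inverseʳ _ ⟩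
            0#               ∎))
        ]′ (psd⇒singularOrDefinite (s ·I- M) sI-M-sym λ v →
              ≤-trans (x≤y⇒0≤y-x (s-form v)) (≤-reflexive (sym (form-·I- s M v))))
      where
      K = proj₁ (form-bounded M)
      supremum = complete P (μ , μ∈P) (K , bounds K (proj₂ (form-bounded M)))
      s = proj₁ supremum
      s-upper = proj₁ (proj₂ supremum)
      s-least = proj₂ (proj₂ supremum)

      sI-M-sym : IsSymmetric (s ·I- M)
      sI-M-sym i j = +-cong (*-congˡ (reflexive (≡.cong fromℤ (δ-sym i j)))) (*-congˡ (M-sym i j))

      lower : ∀ ε → (∀ v → ε * v ∙ v ≤ form (s ·I- M) v) → ∀ v → form M v ≤ (s + - ε) * v ∙ v
      lower ε ε-bound v = ≤-by
        (x≤y⇒0≤y-x (≤-trans (ε-bound v) (≤-reflexive (form-·I- s M v))))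
        (solve 4 (λ s ε w F → (s :- ε) :* w := F :+ ((s :* w :- F) :- ε :* w)) refl s ε (v ∙ v) (form M v))

      -- If e = form M v − s |v|² were positive, then s + δ would lie in P for
      -- δ = e / (e + |v|²).
      s-form : ∀ v → form M v ≤ s * v ∙ v
      s-form v = ≮⇒≥ λ s< →
        let e   = form M v + - (s * v ∙ v)
            0<e = x<y⇒0<y-x s<
            (d , 0<d , dD≈e) = quotient 0<e (+-pos-nonNeg 0<e (∙-nonNeg v))
            F≈ : form M v ≈ (s + d) * v ∙ v + d * e
            F≈ = begin-equality
              form M v
                ≈⟨ solve 3 (λ F s w → F := s :* w :+ (F :- s :* w)) refl (form M v) s (v ∙ v) ⟩
              s * v ∙ v + e
                ≈⟨ +-congˡ dD≈e ⟨
              s * v ∙ v + d * (e + v ∙ v)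
                ≈⟨ solve 4 (λ s d e w → s :* w :+ d :* (e :+ w) := (s :+ d) :* w :+ d :* e) refl s d e (v ∙ v) ⟩
              (s + d) * v ∙ v + d * e
                ∎
            s+d∈P : P (s + d)
            s+d∈P = v , <-by (*-pos 0<d 0<e) F≈
        in <⇒≱ 0<d (begin
          d              ≈⟨ solve 2 (λ s d → d := (s :+ d) :- s) refl s d ⟩
          s + d + - s    ≤⟨ +-monoˡ-≤ (- s) (s-upper (s + d) s+d∈P) ⟩
          s + - s        ≈⟨ -‿inverseʳ s ⟩
          0#             ∎)

  -- Eigenvalues of vertex matrices in coordinates

  module _ (G : Graph) (X : VertexMatrix ℝ G) where
    open Graph G

    indexed : Matrix order
    indexed a b = X (vertex a) (vertex b)

    vertex-index : ∀ i → vertex (index i) ≡ i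
    vertex-index = Inverse.strictlyInverseˡ enumeration

    index-vertex : ∀ a → index (vertex a) ≡ a
    index-vertex = Inverse.strictlyInverseʳ enumeration

    eigenvalue-from-indexed : ∀ {μ} → Eigenvalue indexed μ → IsEigenvalue ℝ G X μ
    eigenvalue-from-indexed {μ} (v , v≉0 , Mv≈μv) = v ∘ index , nonzero , λ i → begin-equality
      (X i ∘ vertex) ∙ (v ∘ index ∘ vertex)
        ≈⟨ ∙-cong (λ b → reflexive (≡.cong (λ k → X k (vertex b)) (≡.sym (vertex-index i))))
                  (λ b → reflexive (≡.cong v (index-vertex b))) ⟩
      indexed (index i) ∙ v
        ≈⟨ Mv≈μv (index i) ⟩
      μ * v (index i)
        ∎
      where
      nonzero : ¬ (∀ i → v (index i) ≈ 0#)
      nonzero v≈0 = v≉0 λ a → trans (reflexive (≡.cong v (≡.sym (index-vertex a)))) (v≈0 (vertex a))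

    eigenvalue-to-indexed : ∀ {μ} → IsEigenvalue ℝ G X μ → Eigenvalue indexed μ
    eigenvalue-to-indexed (v , v≉0 , Xv≈μv) = v ∘ vertex , nonzero , Xv≈μv ∘ vertex
      where
      nonzero : ¬ (∀ a → v (vertex a) ≈ 0#)
      nonzero v≈0 = v≉0 λ i → trans (reflexive (≡.cong v (≡.sym (vertex-index i)))) (v≈0 (index i))

  -- Indicator vectors and the lower bound by independent sets

  indicator : ∀ {n} → Subset n → Vector n
  indicator I i = if lookup I i then 1# else 0#

  sum-indicator : ∀ {n} (I : Subset n) → sum (indicator I) ≈ fromℕ ∣ I ∣
  sum-indicator []          = refl
  sum-indicator (true  ∷ I) = +-congˡ (sum-indicator I)
  sum-indicator (false ∷ I) = trans (+-identityˡ _) (sum-indicator I)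

  indicator-∙ : ∀ {n} (I : Subset n) → indicator I ∙ indicator I ≈ fromℕ ∣ I ∣
  indicator-∙ []          = refl
  indicator-∙ (true  ∷ I) = +-cong (*-identityˡ 1#) (indicator-∙ I)
  indicator-∙ (false ∷ I) = trans (+-congʳ (zeroˡ 0#)) (trans (+-identityˡ _) (indicator-∙ I))

  indicator-∙-mono : ∀ {n} (I : Subset n) {u v : Vector n} → (∀ i → i ∈ I → u i ≤ v i) →
    indicator I ∙ u ≤ indicator I ∙ v
  indicator-∙-mono []          u≤v = ≤-refl
  indicator-∙-mono (true  ∷ I) u≤v =
    +-mono-≤ (*-monoˡ-≤ 0≤1 (u≤v zero here)) (indicator-∙-mono I λ i i∈I → u≤v (suc i) (there i∈I))
  indicator-∙-mono (false ∷ I) u≤v =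
    +-mono-≤ (≤-reflexive (trans (zeroˡ _) (sym (zeroˡ _)))) (indicator-∙-mono I λ i i∈I → u≤v (suc i) (there i∈I))

  -- The all-ones matrix has rank one and form |I|² at χ; since χ is nonnegative and supported on I,
  -- where M dominates that matrix, the forms compare.
  indicator-form : ∀ {n} (M : Matrix n) (I : Subset n) → (∀ i j → i ∈ I → j ∈ I → 1# ≤ M i j) →
    fromℕ ∣ I ∣ * fromℕ ∣ I ∣ ≤ form M (indicator I)
  indicator-form M I 1≤M = begin
    fromℕ ∣ I ∣ * fromℕ ∣ I ∣
      ≈⟨ *-cong 1∙χ≈a 1∙χ≈a ⟨
    ones ∙ χ * ones ∙ χ
      ≈⟨ form-rankOne ones χ ⟨
    form (λ i j → 1# * 1#) χ
      ≤⟨ indicator-∙-mono I (λ i i∈I → row i i∈I) ⟩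
    form M χ
      ∎
    where
    χ = indicator I
    ones = λ _ → 1#
    1∙χ≈a : ones ∙ χ ≈ fromℕ ∣ I ∣
    1∙χ≈a = trans (sum-cong λ i → *-identityˡ (χ i)) (sum-indicator I)
    row : ∀ i → i ∈ I → (λ _ → 1# * 1#) ∙ χ ≤ M i ∙ χ
    row i i∈I = begin
      (λ _ → 1# * 1#) ∙ χ  ≈⟨ ∙-comm _ χ ⟩
      χ ∙ (λ _ → 1# * 1#)  ≤⟨ indicator-∙-mono I (λ j j∈I → ≤-trans (≤-reflexive (*-identityˡ 1#)) (1≤M i j i∈I j∈I)) ⟩
      χ ∙ M i              ≈⟨ ∙-comm χ (M i) ⟩
      M i ∙ χ              ∎

  independent⇒≤ : ∀ (G : Graph) X {μ} → IsFeasible ℝ G X → IsLargestEigenvalue ℝ G X μ →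
    ∀ I → IsIndependent G I → .{{_ : NonZero ∣ I ∣}} → fromℕ ∣ I ∣ ≤ μ
  independent⇒≤ G X {μ} (X-sym , 1≤X) (_ , μ-upper) I I-ind = *-cancelˡ-≤ (fromℕ-pos ∣ I ∣) (begin
    a * a           ≤⟨ indicator-form M I (λ i j i∈I j∈I → 1≤X (vertex i) (vertex j) (I-ind i j i∈I j∈I)) ⟩
    form M χ        ≤⟨ rayleigh M (λ i j → X-sym (vertex i) (vertex j)) μ
                        (λ t t-eig → μ-upper t (eigenvalue-from-indexed G X t-eig)) χ ⟩
    μ * χ ∙ χ       ≈⟨ *-congˡ (indicator-∙ I) ⟩
    μ * a           ≈⟨ *-comm μ a ⟩
    a * μ           ∎)
    where
    open Graph G
    M = indexed G X
    χ = indicator I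
    a = fromℕ ∣ I ∣

  -- The Hamming graph

  module ℤ-Sum = RawMonoidOps ℤ.+-0-rawMonoid

  fromℤ-∙ : ∀ {n} (f g : Fin n → ℤ) → fromℤ (ℤ-Sum.sum λ i → f i ℤ.* g i) ≈ (fromℤ ∘ f) ∙ (fromℤ ∘ g)
  fromℤ-∙ {zero}  f g = refl
  fromℤ-∙ {suc n} f g = trans (fromℤ-+ (f zero ℤ.* g zero) _)
    (+-cong (fromℤ-* (f zero) (g zero)) (fromℤ-∙ (f ∘ suc) (g ∘ suc)))

  -- At an eigenvector v for u the form of tI - M equals (t - u)|v|², and |v|² > 0 cancels.
  psd⇒eigenvalues≤ : ∀ {n} t (M : Matrix n) → PositiveSemidefinite (t ·I- M) → IsUpperBound (Eigenvalue M) t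
  psd⇒eigenvalues≤ t M psd u (v , v≉0 , Mv≈uv) = *-cancelˡ-≤ (∙-pos v v≉0)
    (≤-by (psd v) (begin-equality
      v ∙ v * t
        ≈⟨ solve 3 (λ w t u → w :* t := w :* u :+ (t :* w :- u :* w)) refl (v ∙ v) t u ⟩
      v ∙ v * u + (t * v ∙ v + - (u * v ∙ v))
        ≈⟨ +-congˡ (+-congˡ (-‿cong (trans (∙-cong (λ _ → refl) Mv≈uv) (∙-homoʳ u v v)))) ⟨
      v ∙ v * u + (t * v ∙ v + - form M v)
        ≈⟨ +-congˡ (form-·I- t M v) ⟨
      v ∙ v * u + form (t ·I- M) v
        ∎))

  gram⇒psd : ∀ {n m} (C : Fin n → Vector m) (N : Matrix n) → (∀ i j → C i ∙ C j ≈ N i j + N i j) →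
    PositiveSemidefinite N
  gram⇒psd C N C∙C≈2N v = *-cancelˡ-≤ (+-pos-nonNeg 0<1 0≤1) (begin
    (1# + 1#) * 0#           ≈⟨ zeroʳ _ ⟩
    0#                       ≤⟨ gram-nonNeg C v ⟩
    form (λ i j → C i ∙ C j) v        ≈⟨ form-cong v C∙C≈2N ⟩
    form (λ i j → N i j + N i j) v    ≈⟨ form-+ N N v ⟩
    form N v + form N v               ≈⟨ solve 1 (λ x → x :+ x := (con (+ 1) :+ con (+ 1)) :* x) refl (form N v) ⟩
    (1# + 1#) * form N v     ∎)

  -- As α of the k-th power is at most nᵏ for n the order of G, all the k-th roots are bounded by n;
  -- the power k = 1 provides a member.
  shannonCapacity-exists : ∀ G → ∃[ θ ] IsShannonCapacity ℝ G θ
  shannonCapacity-exists G = complete _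
    ( fromℕ (α G)
    , 1 , _ , fromℕ-nonNeg (α G) , *-identityʳ _ )
    ( fromℕ order
    , λ r (k , k≢0 , r-root) → root-mono-≤ k {{k≢0}} r-root
        (fromℕ-nonNeg order , sym (fromℕ-^ order k))
        (fromℕ-mono-≤ (ℕ.≤-trans (α≤order ((G ^⊠ k) {{k≢0}})) (ℕ.≤-reflexive (order-^⊠ G k {{k≢0}})))) )
    where open Graph G

  optimum : VertexMatrix ℝ hammingGraph
  optimum u v = fromℤ (entry (hammingDistance u v))

  module _ where
    open Graph hammingGraph
    open Hamming

    1≤entry : ∀ d → ¬ (1 ℕ.≤ d × d ℕ.≤ 2) → 1# ≤ fromℤ (entry d)
    1≤entry 0 _ = ≤-refl
    1≤entry 1 d∉[1,2] = contradiction (s≤s z≤n , s≤s z≤n) d∉[1,2]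
    1≤entry 2 d∉[1,2] = contradiction (s≤s z≤n , s≤s (s≤s z≤n)) d∉[1,2]
    1≤entry 3 _ = ≤-refl
    1≤entry 4 _ = ≤-refl
    1≤entry (suc (suc (suc (suc (suc _))))) _ = ≤-by (+-nonNeg 0≤1 0≤1)
      (solve 0 (con (+ 3) := con (+ 1) :+ (con (+ 1) :+ con (+ 1))) refl)

    optimum-feasible : IsFeasible ℝ hammingGraph optimum
    optimum-feasible =
        (λ u v → reflexive (≡.cong (fromℤ ∘ entry) (hammingDistance-sym u v)))
      , (λ u v → 1≤entry (hammingDistance u v))

    fromℤ-gap : ∀ i j → fromℤ (gap i j) ≈ (fromℤ (+ 4) ·I- indexed hammingGraph optimum) i j
    fromℤ-gap i j = trans (fromℤ-+ (+ 4 ℤ.* δ i j) _)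
      (+-cong (fromℤ-* (+ 4) (δ i j)) (fromℤ-* -[1+ 0 ] (entryAt i j)))

    optimum-eigenvalues≤4 : IsUpperBound (IsEigenvalue ℝ hammingGraph optimum) (fromℤ (+ 4))
    optimum-eigenvalues≤4 t t-eig = psd⇒eigenvalues≤ (fromℤ (+ 4)) (indexed hammingGraph optimum)
      (gram⇒psd (λ i → fromℤ ∘ character i) _ gram)
      t (eigenvalue-to-indexed hammingGraph optimum t-eig)
      where
      gram : ∀ i j → (fromℤ ∘ character i) ∙ (fromℤ ∘ character j) ≈
             (fromℤ (+ 4) ·I- indexed hammingGraph optimum) i j + (fromℤ (+ 4) ·I- indexed hammingGraph optimum) i j
      gram i j = begin-equality
        (fromℤ ∘ character i) ∙ (fromℤ ∘ character j)
          ≈⟨ fromℤ-∙ (character i) (character j) ⟨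
        fromℤ (ℤ-Sum.sum (λ k → character i k ℤ.* character j k))
          ≡⟨ ≡.cong fromℤ (gram-characters i j) ⟩
        fromℤ (gap i j ℤ.+ gap i j)
          ≈⟨ fromℤ-+ (gap i j) (gap i j) ⟩
        fromℤ (gap i j) + fromℤ (gap i j)
          ≈⟨ +-cong (fromℤ-gap i j) (fromℤ-gap i j) ⟩
        (fromℤ (+ 4) ·I- indexed hammingGraph optimum) i j + (fromℤ (+ 4) ·I- indexed hammingGraph optimum) i j
          ∎

    optimum-eigenvalue-4 : IsEigenvalue ℝ hammingGraph optimum (fromℤ (+ 4))
    optimum-eigenvalue-4 = eigenvalue-from-indexed hammingGraph optimum
      ( (λ _ → 1#)
      , (λ 1≈0 → 0≉1 (sym (1≈0 zero)))
      , λ i → begin-equality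
          indexed hammingGraph optimum i ∙ (λ _ → 1#)      ≈⟨ fromℤ-∙ (entryAt i) (λ _ → + 1) ⟨
          fromℤ (ℤ-Sum.sum (λ j → entryAt i j ℤ.* + 1))    ≡⟨ ≡.cong fromℤ (rowSum i) ⟩
          fromℤ (+ 4)                                      ≈⟨ *-identityʳ _ ⟨
          fromℤ (+ 4) * 1#                                 ∎ )

  schrijverTheta-hammingGraph : IsSchrijverTheta ℝ hammingGraph (fromℤ (+ 4))
  schrijverTheta-hammingGraph =
      (λ μ (X , X-feasible , μ-largest) →
        let (I , I-ind , 4≤∣I∣) = code₄-independent in begin
          fromℤ (+ 4)    ≈⟨ fromℤ-pos 4 ⟩
          fromℕ 4        ≤⟨ fromℕ-mono-≤ 4≤∣I∣ ⟩
          fromℕ ∣ I ∣    ≤⟨ independent⇒≤ hammingGraph X X-feasible μ-largest I I-ind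
                             {{ℕ.>-nonZero (ℕ.≤-trans (s≤s z≤n) 4≤∣I∣)}} ⟩
          μ              ∎)
    -- The value 4 is attained by `optimum`, so every lower bound is at most 4.
    , (λ b b-lower → b-lower (fromℤ (+ 4)) (optimum , optimum-feasible , optimum-eigenvalue-4 , optimum-eigenvalues≤4))

  separation : ∀ {θ} → IsShannonCapacity ℝ hammingGraph θ → ∃[ √αG⊠G ] ∃[ √20 ]
      ( IsRoot 2 (fromℕ (α (hammingGraph ⊠ hammingGraph))) √αG⊠G
      × IsRoot 2 (fromℕ 20) √20
      × √αG⊠G ≤ θ
      × √20 ≤ √αG⊠G
      × fromℕ 4 < √20
      × ¬ (θ ≤ fromℤ (+ 4)) )
  separation {θ} (θ-upper , _) =
      √αG⊠G , √20 , √αG⊠G-root , √20-root , √αG⊠G≤θ , √20≤√αG⊠G , 4<√20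
    , λ θ≤4 → <⇒≱ 4<√20 (begin
        √20            ≤⟨ √20≤√αG⊠G ⟩
        √αG⊠G          ≤⟨ √αG⊠G≤θ ⟩
        θ              ≤⟨ θ≤4 ⟩
        fromℤ (+ 4)    ≈⟨ fromℤ-pos 4 ⟩
        fromℕ 4        ∎)
    where
    G⊠G = hammingGraph ⊠ hammingGraph
    √αG⊠G = proj₁ (squareRoot (fromℕ-nonNeg (α G⊠G)))
    √αG⊠G-root = proj₂ (squareRoot (fromℕ-nonNeg (α G⊠G)))
    √20 = proj₁ (squareRoot (fromℕ-nonNeg 20))
    √20-root = proj₂ (squareRoot (fromℕ-nonNeg 20))

    √αG⊠G≤θ : √αG⊠G ≤ θ
    √αG⊠G≤θ = θ-upper √αG⊠G (2 , _ , √αG⊠G-root)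

    20≤α : 20 ℕ.≤ α G⊠G
    20≤α = let (I , I-ind , 20≤∣I∣) = code₂₀-independent in
      ℕ.≤-trans 20≤∣I∣ (independent⇒≤α G⊠G I I-ind)

    √20≤√αG⊠G : √20 ≤ √αG⊠G
    √20≤√αG⊠G = root-mono-≤ 2 √20-root √αG⊠G-root (fromℕ-mono-≤ 20≤α)

    4<√20 : fromℕ 4 < √20
    -- 17 ≤ 17 + 3 is 16 < 20; squaring √20 ≤ 4 would give the opposite.
    4<√20 = ≰⇒> λ √20≤4 → <⇒≱ (fromℕ-mono-< (ℕ.m≤m+n 17 3)) (begin
      fromℕ 20     ≈⟨ proj₂ √20-root ⟨
      √20 ^ 2      ≤⟨ ^-mono-≤ 2 (proj₁ √20-root) √20≤4 ⟩
      fromℕ 4 ^ 2  ≈⟨ fromℕ-^ 4 2 ⟨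
      fromℕ 16     ∎)

mainTheorem1 : (ℝ : RealNumbers) →
    let open RealNumbers ℝ
        G = hammingGraph in
    (∃[ θ ] ∃[ √αG⊠G ] ∃[ √20 ] ∃[ ϑ′ ]
      ( IsShannonCapacity ℝ G θ
      × IsRoot 2 (fromℕ (α (G ⊠ G))) √αG⊠G
      × IsRoot 2 (fromℕ 20) √20
      × IsSchrijverTheta ℝ G ϑ′
      × √αG⊠G ≤ θ
      × √20 ≤ √αG⊠G
      × fromℕ 4 < √20
      × ϑ′ ≈ fromℕ 4
      × ¬ (θ ≤ ϑ′) ))
    × ¬ (∀ (H : Graph) θ ϑ′ → IsShannonCapacity ℝ H θ → IsSchrijverTheta ℝ H ϑ′ → θ ≤ ϑ′)
mainTheorem1 ℝ =
  let (θ , θ-capacity) = shannonCapacity-exists hammingGraph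
      (√αG⊠G , √20 , √αG⊠G-root , √20-root , √αG⊠G≤θ , √20≤√αG⊠G , 4<√20 , θ≰4) = separation θ-capacity
  in
    ( θ , √αG⊠G , √20 , fromℤ (+ 4) , θ-capacity , √αG⊠G-root , √20-root
    , schrijverTheta-hammingGraph , √αG⊠G≤θ , √20≤√αG⊠G , 4<√20 , fromℤ-pos 4 , θ≰4 )
  , λ Θ≤ϑ′ → θ≰4 (Θ≤ϑ′ hammingGraph θ _ θ-capacity schrijverTheta-hammingGraph)
  where open Real ℝ
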